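{- Let $(X_1,Y_1,Y'_1),\ldots,(X_n,Y_n,Y'_n)$ be a sequence of independent triples of Bernoulli random variables (triples mutually independent; variables within a triple may be dependent) such that $\mathbb{E}[X_i]=p_i$, $\mathbb{E}[Y_i]=q_i$, $\mathbb{E}[Y'_i]=q'_i$ and $\mathbb{E}[X_iY_i]=0$ (i.e., $X_i$ and $Y_i$ are never both $1$). Suppose further that for each $i$ either (a) $q'_i=0$, or (b) $q_i=1-p_i$, and $X_i=\mathbf{1}(\theta_i<p_i)$ and $Y'_i=\mathbf{1}(\theta_i<q'_i)$ for a threshold $\theta_i$ chosen uniformly in $[0,1]$. Let $X=\sum_i X_i$, $Y=\sum_i(Y_i+Y'_i)$, $\mu_x=\mathbb{E}[X]$, $\mu_y=\mathbb{E}[Y]$. If $\mu_x+\mu_y>1$, then $$\frac{\mu_x-1}{\mu_x+\mu_y-1}\le\mathbb{E}\Big[\frac{X}{X+Y}\Big]\le\frac{\mu_x}{\mu_x+\mu_y-1}.$$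
   Context: Convention: in the expression $\frac{X}{X+Y}$, the value $0/0$ is interpreted as $1$ for the left inequality and as $0$ for the right inequality. $\mathbf{1}(\cdot)$ denotes the indicator of an event. -}

module Defs where

open import Algebra.Bundles using (CommutativeRing)
open import Algebra.Core using (Op₁; Op₂)
open import Algebra.Structures using (IsCommutativeRing)
import Algebra.Properties.Monoid.Mult as MonoidMult
open import Data.Bool using (Bool; true; false; not; _∧_; _∨_)
import Data.Bool.Properties as Bool
open import Data.Fin using (Fin)
open import Data.List as List using (List; []; _∷_; cartesianProduct; cartesianProductWith)
open import Data.List.Membership.Propositional using (_∈_)
open import Data.List.Membership.Propositional.Properties using (∈-cartesianProduct⁺; ∈-cartesianProductWith⁺)
open import Data.List.Relation.Unary.All using ([]; _∷_)
open import Data.List.Relation.Unary.AllPairs using ([]; _∷_)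
open import Data.List.Relation.Unary.Any using (here; there)
open import Data.List.Relation.Unary.Unique.Propositional using (Unique)
open import Data.List.Relation.Unary.Unique.Propositional.Properties using (cartesianProduct⁺; cartesianProductWith⁺)
open import Data.Nat as ℕ using (ℕ; zero; suc)
open import Data.Product using (_×_; _,_)
open import Data.Product.Properties using () renaming (≡-dec to ×-≡-dec)
open import Data.Vec as Vec using (Vec; []; _∷_)
import Data.Vec.Functional as Vector
open import Data.Vec.Properties using (∷-injective) renaming (≡-dec to Vec-≡-dec)
open import Level using (Level; _⊔_) renaming (suc to lsuc)
open import Relation.Binary.Core using (Rel)
open import Relation.Binary.Definitions using (Decidable; DecidableEquality)
open import Relation.Binary.Structures using (IsDecTotalOrder)
import Relation.Binary.Construct.NonStrictToStrict as ToStrict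
open import Relation.Binary.PropositionalEquality using (_≡_; refl)
open import Relation.Nullary.Decidable using (does)
open import Relation.Nullary.Negation using (¬_)

private
  variable
    c ℓ₁ ℓ₂ o m a b : Level

-- The real numbers enter only through the axioms of a (classical, i.e.
-- decidably and totally) ordered field.  The value of 0# ⁻¹ is unspecified.
record OrderedField c ℓ₁ ℓ₂ : Set (lsuc (c ⊔ ℓ₁ ⊔ ℓ₂)) where
  infix  8 _⁻¹
  infix  8 -_
  infixl 7 _*_ _/_
  infixl 6 _+_ _-_
  infix  4 _≈_ _≤_ _<_ _<?_
  field
    Carrier           : Set c
    _≈_               : Rel Carrier ℓ₁
    _≤_               : Rel Carrier ℓ₂
    _+_ _*_           : Op₂ Carrier
    -_ _⁻¹            : Op₁ Carrier
    0# 1#             : Carrier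
    isCommutativeRing : IsCommutativeRing _≈_ _+_ _*_ -_ 0# 1#
    isDecTotalOrder   : IsDecTotalOrder _≈_ _≤_
    0≉1               : ¬ (0# ≈ 1#)
    ⁻¹-cong           : ∀ {x y} → x ≈ y → x ⁻¹ ≈ y ⁻¹
    *-inverseʳ        : ∀ {x} → ¬ (x ≈ 0#) → x * x ⁻¹ ≈ 1#
    +-monoˡ-≤         : ∀ {x y} z → x ≤ y → x + z ≤ y + z
    *-nonNegative     : ∀ {x y} → 0# ≤ x → 0# ≤ y → 0# ≤ x * y

  commutativeRing : CommutativeRing c ℓ₁
  commutativeRing = record { isCommutativeRing = isCommutativeRing }

  open MonoidMult (CommutativeRing.+-monoid commutativeRing) public
    using () renaming (_×_ to _·_)

  _-_ _/_ : Op₂ Carrier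
  x - y = x + (- y)
  x / y = x * y ⁻¹

  _<_ : Rel Carrier (ℓ₁ ⊔ ℓ₂)
  _<_ = ToStrict._<_ _≈_ _≤_

  _<?_ : Decidable _<_
  _<?_ = ToStrict.<-decidable _≈_ _≤_ (IsDecTotalOrder._≟_ isDecTotalOrder) (IsDecTotalOrder._≤?_ isDecTotalOrder)

  fromℕ : ℕ → Carrier
  fromℕ k = k · 1#

-- Only finite additivity is required, so every (σ-additive) probability space
-- is an instance.  An event is given by its indicator function, and ℙ is a
-- total function whose values outside the algebra of measurable events are
-- unconstrained.
record ProbabilitySpace (F : OrderedField c ℓ₁ ℓ₂) o m : Set (c ⊔ ℓ₁ ⊔ ℓ₂ ⊔ lsuc (o ⊔ m)) where
  open OrderedField F
  field
    Ω          : Set o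
    Measurable : (Ω → Bool) → Set m
    ℙ          : (Ω → Bool) → Carrier

    measurable-cong : ∀ {A B} → (∀ ω → A ω ≡ B ω) → Measurable A → Measurable B
    measurable-Ω    : Measurable (λ _ → true)
    measurable-∁    : ∀ {A} → Measurable A → Measurable (λ ω → not (A ω))
    measurable-∩    : ∀ {A B} → Measurable A → Measurable B → Measurable (λ ω → A ω ∧ B ω)

    ℙ-cong     : ∀ {A B} → (∀ ω → A ω ≡ B ω) → ℙ A ≈ ℙ B
    ℙ-nonNeg   : ∀ {A} → Measurable A → 0# ≤ ℙ A
    ℙ-Ω        : ℙ (λ _ → true) ≈ 1#
    ℙ-additive : ∀ {A B} → Measurable A → Measurable B → (∀ ω → A ω ∧ B ω ≡ false) →
                 ℙ (λ ω → A ω ∨ B ω) ≈ ℙ A + ℙ B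

record Finite (A : Set a) : Set a where
  field
    _≟_      : DecidableEquality A
    elements : List A
    complete : ∀ x → x ∈ elements
    unique   : Unique elements

instance
  finite-Bool : Finite Bool
  finite-Bool = record
    { _≟_      = Bool._≟_
    ; elements = false ∷ true ∷ []
    ; complete = λ { false → here refl ; true → there (here refl) }
    ; unique   = ((λ ()) ∷ []) ∷ [] ∷ []
    }

  finite-× : {A : Set a} {B : Set b} → {{Finite A}} → {{Finite B}} → Finite (A × B)
  finite-× {{A}} {{B}} = record
    { _≟_      = ×-≡-dec (Finite._≟_ A) (Finite._≟_ B)
    ; elements = cartesianProduct (Finite.elements A) (Finite.elements B)
    ; complete = λ { (x , y) → ∈-cartesianProduct⁺ (Finite.complete A x) (Finite.complete B y) }
    ; unique   = cartesianProduct⁺ (Finite.unique A) (Finite.unique B)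
    }

  finite-Vec : {A : Set a} {n : ℕ} → {{Finite A}} → Finite (Vec A n)
  finite-Vec {A = A} {n} {{F}} = record
    { _≟_      = Vec-≡-dec (Finite._≟_ F)
    ; elements = vectors n
    ; complete = vectors-complete
    ; unique   = vectors-unique n
    }
    where
    vectors : ∀ k → List (Vec A k)
    vectors zero    = [] ∷ []
    vectors (suc k) = cartesianProductWith _∷_ (Finite.elements F) (vectors k)

    vectors-complete : ∀ {k} (v : Vec A k) → v ∈ vectors k
    vectors-complete []      = here refl
    vectors-complete (x ∷ v) = ∈-cartesianProductWith⁺ _∷_ (Finite.complete F x) (vectors-complete v)

    vectors-unique : ∀ k → Unique (vectors k)
    vectors-unique zero    = [] ∷ []
    vectors-unique (suc k) = cartesianProductWith⁺ _∷_ ∷-injective (Finite.unique F) (vectors-unique k)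

module Probability (F : OrderedField c ℓ₁ ℓ₂) (S : ProbabilitySpace F o m) where
  open OrderedField F
  open ProbabilitySpace S

  -- 𝔼 Z g is E[g(Z)] = Σₐ g(a) ℙ(Z = a), for Z with values in a finite type.
  𝔼 : {A : Set a} → {{Finite A}} → (Ω → A) → (A → Carrier) → Carrier
  𝔼 {{A}} Z g = List.foldr _+_ 0# (List.map (λ x → g x * ℙ (λ ω → does (Finite._≟_ A (Z ω) x))) (Finite.elements A))

  -- Mutual independence.  Subfamilies are covered by taking B i to be
  -- constantly true at the remaining indices.
  Independent : {A : Set a} {n : ℕ} → (Fin n → Ω → A) → Set (a ⊔ ℓ₁)
  Independent {A = A} {n} Z = (B : Fin n → A → Bool) →
    ℙ (λ ω → Vector.foldr _∧_ true (λ i → B i (Z i ω)))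
      ≈ Vector.foldr _*_ 1# (λ i → ℙ (λ ω → B i (Z i ω)))

  record Uniform[0,1] (θ : Ω → Carrier) : Set (c ⊔ ℓ₁ ⊔ ℓ₂ ⊔ o ⊔ m) where
    field
      measurable  : ∀ t → Measurable (λ ω → does (θ ω <? t))
      lower-bound : ∀ ω → 0# ≤ θ ω
      upper-bound : ∀ ω → θ ω ≤ 1#
      cdf         : ∀ t → 0# ≤ t → t ≤ 1# → ℙ (λ ω → does (θ ω <? t)) ≈ t

  -- X/(X+Y) for counts, with 0/0 read as the first argument.
  ratio : Carrier → ℕ → ℕ → Carrier
  ratio 0/0 zero zero = 0/0
  ratio 0/0 x    y    = fromℕ x / fromℕ (x ℕ.+ y)

bit : Bool → ℕ
bit false = 0
bit true  = 1

Triple : Set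
Triple = Bool × Bool × Bool

∑X ∑Y : ∀ {n} → Vec Triple n → ℕ
∑X t = Vec.sum (Vec.map (λ { (x , _ , _)  → bit x }) t)
∑Y t = Vec.sum (Vec.map (λ { (_ , y , y′) → bit y ℕ.+ bit y′ }) t)

{-# OPTIONS --safe #-}
module Submission where

-- Let W be a sum of independent Bernoulli variables.  Size-biasing gives
-- E[W] E[1/(1+W)] ≤ P(W > 0) ≤ 1.  The total count Z of all triples is such a
-- sum: up to null events a triple contributes one Bernoulli variable in case
-- (a), and the constant 1 plus the independent variable Y′ᵢ in case (b).
-- Splitting E[X/Z] = ∑ᵢ E[Xᵢ/Z] and conditioning on the i-th triple, each
-- summand is at most E[Xᵢ]/(E[Z] - 1); the same holds for Yᵢ + Y′ᵢ in place
-- of Xᵢ.  Summing over i gives the upper bound, and, since X/Z + Y/Z = 1, also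
-- the lower bound.

open import Defs
open import Algebra.Bundles using (CommutativeRing)
import Algebra.Properties.Monoid.Mult as MonoidMult
open import Algebra.Properties.CommutativeSemigroup using (interchange)
import Algebra.Solver.Ring.NaturalCoefficients.Default as RingSolver
open import Data.Bool using (Bool; true; false; not; _∧_; _∨_)
import Data.Bool.Properties as Bool
open import Data.Empty using (⊥-elim)
open import Data.Fin using (Fin; zero; suc)
open import Data.List as List using (List; []; _∷_; _++_; cartesianProductWith)
open import Data.List.Membership.Propositional using (_∈_)
open import Data.List.Membership.Propositional.Properties using (∈-cartesianProductWith⁺)
open import Data.List.Membership.Propositional.Properties.WithK using (unique∧set⇒bag)
open import Data.List.Relation.Binary.BagAndSetEquality using (∼bag⇒↭)
open import Data.List.Relation.Binary.Permutation.Propositional using (_↭_; refl; prep; swap; trans)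
open import Data.List.Relation.Unary.All using (All; []; _∷_)
open import Data.List.Relation.Unary.AllPairs using ([]; _∷_)
open import Data.List.Relation.Unary.Any using (here; there)
open import Data.List.Relation.Unary.Unique.Propositional using (Unique)
open import Data.List.Relation.Unary.Unique.Propositional.Properties using (cartesianProductWith⁺)
open import Data.Nat as ℕ using (ℕ; zero; suc)
import Data.Nat.Properties as ℕ
open import Data.Product using (_×_; _,_; proj₁; proj₂; Σ-syntax)
open import Data.Product.Properties using () renaming (≡-dec to ×-≡-dec)
open import Data.Sum as Sum using (_⊎_; inj₁; inj₂)
open import Data.Vec as Vec using (Vec; []; _∷_; tabulate; lookup)
import Data.Vec.Functional as Vector
open import Data.Vec.Properties using (∷-injective)
open import Function using (_∘_; mk⇔)
open import Level using (Level; _⊔_)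
open import Relation.Binary.Bundles using (Poset)
open import Relation.Binary.Definitions using (DecidableEquality)
open import Relation.Binary.PropositionalEquality as ≡ using (_≡_; _≢_)
import Relation.Binary.Reasoning.PartialOrder as PosetReasoning
open import Relation.Binary.Structures using (IsDecTotalOrder)
open import Relation.Nullary.Decidable using (Dec; does; yes; no; dec-true; dec-false)
open import Relation.Nullary.Negation using (¬_)

-- Write D = E[Z] - 1 and let W be the total size of the triples other than the i-th. In case (a) a
-- triple that counts has size exactly 1 and its mean size is at most 1, so D ≤ E[W] and D
-- E[1/(1+W)] ≤ 1; this is where the -1 in the denominators comes from. In case (b) the size is 1 +
-- Y′ᵢ and D = E[W] + q′ᵢ. Given Y′ᵢ = 1 the bound D E[1/(2+W)] ≤ 1 still holds, but given Y′ᵢ = 0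
-- the quantity D E[1/(1+W)] may exceed 1, and only the average over Y′ᵢ is controlled. A numerator
-- Xᵢ concentrated on Y′ᵢ = 0 could thus spoil its summand. The common threshold excludes this:
-- either Xᵢ ≤ Y′ᵢ, and Xᵢ meets only the good value, or Y′ᵢ ≤ Xᵢ, and Xᵢ contains all of Y′ᵢ = 1,
-- so that the averaged bound survives the removal of the weight outside Xᵢ.

private
  variable
    a b d : Level
    A : Set a
    B : Set b
    C : Set d

-- Arithmetic in an ordered field and reciprocals of natural numbers.

module OrderedFieldProperties {c ℓ₁ ℓ₂ : Level} (F : OrderedField c ℓ₁ ℓ₂) where

  open OrderedField F
  open CommutativeRing commutativeRing public
    using (+-cong; +-congˡ; +-congʳ; +-comm; +-assoc; +-identityˡ; +-identityʳ; -‿inverseʳ; -‿inverseˡ; -‿cong;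
           *-cong; *-congˡ; *-congʳ; *-comm; *-identityˡ; *-identityʳ; zeroˡ; zeroʳ; distribˡ; distribʳ)
    renaming (refl to ≈-refl; sym to ≈-sym; trans to ≈-trans; reflexive to ≈-reflexive)
  open IsDecTotalOrder isDecTotalOrder public
    using (antisym) renaming (total to ≤-total; refl to ≤-refl; reflexive to ≤-reflexive; trans to ≤-trans)
  open RingSolver (CommutativeRing.commutativeSemiring commutativeRing) public
    using (solve; _:=_; _:+_; _:*_; con)

  poset : Poset c ℓ₁ ℓ₂
  poset = record { isPartialOrder = IsDecTotalOrder.isPartialOrder isDecTotalOrder }

  open PosetReasoning poset public

  +-mono-≤ : ∀ {x y u v} → x ≤ y → u ≤ v → x + u ≤ y + v
  +-mono-≤ {x} {y} {u} {v} x≤y u≤v = begin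
    x + u ≤⟨ +-monoˡ-≤ u x≤y ⟩
    y + u ≈⟨ +-comm y u ⟩
    u + y ≤⟨ +-monoˡ-≤ y u≤v ⟩
    v + y ≈⟨ +-comm v y ⟩
    y + v ∎

  +-cancelʳ-≤ : ∀ z {x y} → x + z ≤ y + z → x ≤ y
  +-cancelʳ-≤ z {x} {y} x+z≤y+z = begin
    x           ≈⟨ cancel x ⟨
    x + z - z   ≤⟨ +-monoˡ-≤ (- z) x+z≤y+z ⟩
    y + z - z   ≈⟨ cancel y ⟩
    y           ∎
    where
    cancel : ∀ w → w + z - z ≈ w
    cancel w = ≈-trans (+-assoc w z (- z)) (≈-trans (+-congˡ (-‿inverseʳ z)) (+-identityʳ w))

  +-nonNegative : ∀ {x y} → 0# ≤ x → 0# ≤ y → 0# ≤ x + y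
  +-nonNegative 0≤x 0≤y = ≤-trans (≤-reflexive (≈-sym (+-identityˡ 0#))) (+-mono-≤ 0≤x 0≤y)

  x≤y+x : ∀ {x y} → 0# ≤ y → x ≤ y + x
  x≤y+x {x} {y} 0≤y = ≤-trans (≤-reflexive (≈-sym (+-identityˡ x))) (+-monoˡ-≤ x 0≤y)

  x≤x+y : ∀ {x y} → 0# ≤ y → x ≤ x + y
  x≤x+y {x} {y} 0≤y = ≤-trans (x≤y+x 0≤y) (≤-reflexive (+-comm y x))

  *-monoˡ-≤ : ∀ z {x y} → 0# ≤ z → x ≤ y → z * x ≤ z * y
  *-monoˡ-≤ z {x} {y} 0≤z x≤y = begin
    z * x                 ≤⟨ x≤y+x (*-nonNegative 0≤z 0≤y-x) ⟩
    z * (y - x) + z * x   ≈⟨ distribˡ z (y - x) x ⟨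
    z * (y - x + x)       ≈⟨ *-congˡ (≈-trans (+-assoc y (- x) x) (≈-trans (+-congˡ (-‿inverseˡ x)) (+-identityʳ y))) ⟩
    z * y                 ∎
    where
    0≤y-x : 0# ≤ y - x
    0≤y-x = ≤-trans (≤-reflexive (≈-sym (-‿inverseʳ x))) (+-monoˡ-≤ (- x) x≤y)

  *-monoʳ-≤ : ∀ z {x y} → 0# ≤ z → x ≤ y → x * z ≤ y * z
  *-monoʳ-≤ z {x} {y} 0≤z x≤y = begin
    x * z ≈⟨ *-comm x z ⟩
    z * x ≤⟨ *-monoˡ-≤ z 0≤z x≤y ⟩
    z * y ≈⟨ *-comm z y ⟩
    y * z ∎

  x+y≈0⇒x≈0 : ∀ {x y} → 0# ≤ x → 0# ≤ y → x + y ≈ 0# → x ≈ 0#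
  x+y≈0⇒x≈0 0≤x 0≤y x+y≈0 = antisym (≤-trans (x≤x+y 0≤y) (≤-reflexive x+y≈0)) 0≤x

  0≤1 : 0# ≤ 1#
  0≤1 with ≤-total 0# 1#
  ... | inj₁ 0≤1 = 0≤1
  ... | inj₂ 1≤0 = begin
    0#                     ≤⟨ *-nonNegative 0≤-1 0≤-1 ⟩
    -- The semiring solver treats `- 1#` as an indeterminate x, so x + 1 = 0 is inserted by hand and
    -- the solver only sees x * x + (x + 1) = x * (x + 1) + 1.
    - 1# * - 1#            ≈⟨ +-identityʳ _ ⟨
    - 1# * - 1# + 0#       ≈⟨ +-congˡ (-‿inverseˡ 1#) ⟨
    - 1# * - 1# + (- 1# + 1#)   ≈⟨ solve 1 (λ x → x :* x :+ (x :+ con 1) := x :* (x :+ con 1) :+ con 1) ≈-refl (- 1#) ⟩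
    - 1# * (- 1# + 1#) + 1#   ≈⟨ +-congʳ (≈-trans (*-congˡ (-‿inverseˡ 1#)) (zeroʳ (- 1#))) ⟩
    0# + 1#                ≈⟨ +-identityˡ 1# ⟩
    1#                     ∎
    where
    0≤-1 : 0# ≤ - 1#
    0≤-1 = begin
      0#          ≈⟨ -‿inverseʳ 1# ⟨
      1# + - 1#   ≤⟨ +-monoˡ-≤ (- 1#) 1≤0 ⟩
      0# + - 1#   ≈⟨ +-identityˡ (- 1#) ⟩
      - 1#        ∎

  ⁻¹-nonNegative : ∀ {x} → 0# ≤ x → ¬ (x ≈ 0#) → 0# ≤ x ⁻¹
  ⁻¹-nonNegative {x} 0≤x x≉0 with ≤-total 0# (x ⁻¹)
  ... | inj₁ 0≤x⁻¹ = 0≤x⁻¹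
  ... | inj₂ x⁻¹≤0 = ⊥-elim (0≉1 (antisym 0≤1 (begin
    1#       ≈⟨ *-inverseʳ x≉0 ⟨
    x * x ⁻¹ ≤⟨ *-monoˡ-≤ x 0≤x x⁻¹≤0 ⟩
    x * 0#   ≈⟨ zeroʳ x ⟩
    0#       ∎)))

  ⁻¹-antitone : ∀ {x y} → 0# ≤ x → ¬ (x ≈ 0#) → 0# ≤ y → ¬ (y ≈ 0#) → x ≤ y → y ⁻¹ ≤ x ⁻¹
  ⁻¹-antitone {x} {y} 0≤x x≉0 0≤y y≉0 x≤y = begin
    y ⁻¹                ≈⟨ *-identityˡ (y ⁻¹) ⟨
    1# * y ⁻¹           ≈⟨ *-congʳ (*-inverseʳ x≉0) ⟨
    x * x ⁻¹ * y ⁻¹     ≤⟨ *-monoʳ-≤ (y ⁻¹) (⁻¹-nonNegative 0≤y y≉0) (*-monoʳ-≤ (x ⁻¹) (⁻¹-nonNegative 0≤x x≉0) x≤y) ⟩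
    y * x ⁻¹ * y ⁻¹     ≈⟨ solve 3 (λ a b c → a :* b :* c := a :* c :* b) ≈-refl y (x ⁻¹) (y ⁻¹) ⟩
    y * y ⁻¹ * x ⁻¹     ≈⟨ *-congʳ (*-inverseʳ y≉0) ⟩
    1# * x ⁻¹           ≈⟨ *-identityˡ (x ⁻¹) ⟩
    x ⁻¹                ∎

  fromℕ-+ : ∀ m n → fromℕ (m ℕ.+ n) ≈ fromℕ m + fromℕ n
  fromℕ-+ = MonoidMult.×-homo-+ (CommutativeRing.+-monoid commutativeRing) 1#

  fromℕ-nonNegative : ∀ n → 0# ≤ fromℕ n
  fromℕ-nonNegative zero    = ≤-refl
  fromℕ-nonNegative (suc n) = +-nonNegative 0≤1 (fromℕ-nonNegative n)

  fromℕ-suc≉0 : ∀ n → ¬ (fromℕ (suc n) ≈ 0#)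
  fromℕ-suc≉0 n 1+n≈0 = 0≉1 (≈-sym (x+y≈0⇒x≈0 0≤1 (fromℕ-nonNegative n) 1+n≈0))

  -- 1/0 is read as 0, which makes n * (1/n) an indicator.
  recip : ℕ → Carrier
  recip zero    = 0#
  recip (suc n) = fromℕ (suc n) ⁻¹

  recip-nonNegative : ∀ n → 0# ≤ recip n
  recip-nonNegative zero    = ≤-refl
  recip-nonNegative (suc n) = ⁻¹-nonNegative (fromℕ-nonNegative (suc n)) (fromℕ-suc≉0 n)

  -- The range starts at 1 because `recip 0` is 0, below `recip 1`. The size-biasing argument
  -- compares values at positive arguments only, so this range suffices there.
  recip-antitone : ∀ n → recip (suc (suc n)) ≤ recip (suc n)
  recip-antitone n = ⁻¹-antitone (fromℕ-nonNegative (suc n)) (fromℕ-suc≉0 n)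
    (fromℕ-nonNegative (suc (suc n))) (fromℕ-suc≉0 (suc n)) (x≤y+x 0≤1)

  n*recip≤1 : ∀ n → fromℕ n * recip n ≤ 1#
  n*recip≤1 zero    = ≤-trans (≤-reflexive (zeroʳ 0#)) 0≤1
  n*recip≤1 (suc n) = ≤-reflexive (*-inverseʳ (fromℕ-suc≉0 n))

-- Finite sums over lists.

module Sums {c ℓ₁ ℓ₂ : Level} (F : OrderedField c ℓ₁ ℓ₂) where

  open OrderedField F
  open OrderedFieldProperties F

  ∑ : List A → (A → Carrier) → Carrier
  ∑ xs f = List.foldr _+_ 0# (List.map f xs)

  ∑-cong : ∀ (xs : List A) {f g : A → Carrier} → (∀ x → f x ≈ g x) → ∑ xs f ≈ ∑ xs g
  ∑-cong []       f≈g = ≈-refl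
  ∑-cong (x ∷ xs) f≈g = +-cong (f≈g x) (∑-cong xs f≈g)

  ∑-+ : ∀ (xs : List A) (f g : A → Carrier) → ∑ xs (λ x → f x + g x) ≈ ∑ xs f + ∑ xs g
  ∑-+ []       f g = ≈-sym (+-identityˡ 0#)
  ∑-+ (x ∷ xs) f g = ≈-trans (+-congˡ (∑-+ xs f g))
    (solve 4 (λ p q r s → p :+ q :+ (r :+ s) := p :+ r :+ (q :+ s)) ≈-refl (f x) (g x) (∑ xs f) (∑ xs g))

  ∑-*ˡ : ∀ (xs : List A) k (f : A → Carrier) → ∑ xs (λ x → k * f x) ≈ k * ∑ xs f
  ∑-*ˡ []       k f = ≈-sym (zeroʳ k)
  ∑-*ˡ (x ∷ xs) k f = ≈-trans (+-congˡ (∑-*ˡ xs k f)) (≈-sym (distribˡ k (f x) (∑ xs f)))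

  ∑-++ : ∀ (xs ys : List A) (f : A → Carrier) → ∑ (xs ++ ys) f ≈ ∑ xs f + ∑ ys f
  ∑-++ []       ys f = ≈-sym (+-identityˡ _)
  ∑-++ (x ∷ xs) ys f = ≈-trans (+-congˡ (∑-++ xs ys f)) (≈-sym (+-assoc _ _ _))

  ∑-map : ∀ (xs : List A) (g : A → B) (f : B → Carrier) → ∑ (List.map g xs) f ≈ ∑ xs (f ∘ g)
  ∑-map []       g f = ≈-refl
  ∑-map (x ∷ xs) g f = +-congˡ (∑-map xs g f)

  ∑-cartesianProductWith : ∀ (g : A → B → C) (xs : List A) (ys : List B) (f : C → Carrier) →
    ∑ (cartesianProductWith g xs ys) f ≈ ∑ xs (λ x → ∑ ys (λ y → f (g x y)))
  ∑-cartesianProductWith g []       ys f = ≈-refl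
  ∑-cartesianProductWith g (x ∷ xs) ys f = ≈-trans (∑-++ (List.map (g x) ys) _ f)
    (+-cong (∑-map ys (g x) f) (∑-cartesianProductWith g xs ys f))

  ∑-↭ : ∀ {xs ys : List A} (f : A → Carrier) → xs ↭ ys → ∑ xs f ≈ ∑ ys f
  ∑-↭ f refl         = ≈-refl
  ∑-↭ f (prep x p)   = +-congˡ (∑-↭ f p)
  ∑-↭ f (swap {xs} {ys} x y p) = ≈-trans (+-congˡ (+-congˡ (∑-↭ f p)))
    (solve 3 (λ p q r → p :+ (q :+ r) := q :+ (p :+ r)) ≈-refl (f x) (f y) (∑ ys f))
  ∑-↭ f (trans p q)  = ≈-trans (∑-↭ f p) (∑-↭ f q)

-- Sums of independent Bernoulli variables and size-biasing.

module BernoulliSums {c ℓ₁ ℓ₂ : Level} (F : OrderedField c ℓ₁ ℓ₂) where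

  open OrderedField F
  open OrderedFieldProperties F

  -- Carrying the failure probability separately keeps all identities below
  -- free of subtraction.
  record Bernoulli : Set (c ⊔ ℓ₁ ⊔ ℓ₂) where
    field
      failure success : Carrier
      0≤failure : 0# ≤ failure
      0≤success : 0# ≤ success
      sum≈1     : failure + success ≈ 1#

  open Bernoulli

  -- 𝔼-shift β G k is E[G(k + B)] with B distributed as β.
  𝔼-shift : Bernoulli → (ℕ → Carrier) → ℕ → Carrier
  𝔼-shift β G k = failure β * G k + success β * G (suc k)

  -- Averaging over one variable at a time builds in the independence: the value at k is
  -- E[G(k + W)], where W is a sum of independent variables with laws `βs`.
  𝔼-shifts : List Bernoulli → (ℕ → Carrier) → ℕ → Carrier
  𝔼-shifts []       G = G
  𝔼-shifts (β ∷ βs) G = 𝔼-shift β (𝔼-shifts βs G)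

  mean : List Bernoulli → Carrier
  mean []       = 0#
  mean (β ∷ βs) = success β + mean βs

  mean-++ : ∀ βs γs → mean (βs ++ γs) ≈ mean βs + mean γs
  mean-++ []       γs = ≈-sym (+-identityˡ _)
  mean-++ (β ∷ βs) γs = ≈-trans (+-congˡ (mean-++ βs γs)) (≈-sym (+-assoc _ _ _))

  𝔼-shifts-++ : ∀ βs γs G k → 𝔼-shifts (βs ++ γs) G k ≡ 𝔼-shifts βs (𝔼-shifts γs G) k
  𝔼-shifts-++ []       γs G k = ≡.refl
  𝔼-shifts-++ (β ∷ βs) γs G k =
    ≡.cong₂ (λ x y → failure β * x + success β * y) (𝔼-shifts-++ βs γs G k) (𝔼-shifts-++ βs γs G (suc k))

  𝔼-shift-cong : ∀ β {G H} → (∀ k → G k ≈ H k) → ∀ k → 𝔼-shift β G k ≈ 𝔼-shift β H k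
  𝔼-shift-cong β G≈H k = +-cong (*-congˡ (G≈H k)) (*-congˡ (G≈H (suc k)))

  𝔼-shifts-cong : ∀ βs {G H} → (∀ k → G k ≈ H k) → ∀ k → 𝔼-shifts βs G k ≈ 𝔼-shifts βs H k
  𝔼-shifts-cong []       G≈H = G≈H
  𝔼-shifts-cong (β ∷ βs) G≈H = 𝔼-shift-cong β (𝔼-shifts-cong βs G≈H)

  𝔼-shifts-linear : ∀ βs x (G H : ℕ → Carrier) k →
    𝔼-shifts βs (λ j → G j + x * H j) k ≈ 𝔼-shifts βs G k + x * 𝔼-shifts βs H k
  𝔼-shifts-linear []       x G H k = ≈-refl
  𝔼-shifts-linear (β ∷ βs) x G H k = ≈-trans (𝔼-shift-cong β (𝔼-shifts-linear βs x G H) k)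
    (solve 7 (λ u s x g₀ h₀ g₁ h₁ → u :* (g₀ :+ x :* h₀) :+ s :* (g₁ :+ x :* h₁)
                                  := u :* g₀ :+ s :* g₁ :+ x :* (u :* h₀ :+ s :* h₁)) ≈-refl
      (failure β) (success β) x (𝔼-shifts βs G k) (𝔼-shifts βs H k) (𝔼-shifts βs G (suc k)) (𝔼-shifts βs H (suc k)))

  𝔼-shifts-suc : ∀ βs G k → 𝔼-shifts βs (G ∘ suc) k ≡ 𝔼-shifts βs G (suc k)
  𝔼-shifts-suc []       G k = ≡.refl
  𝔼-shifts-suc (β ∷ βs) G k =
    ≡.cong₂ (λ x y → failure β * x + success β * y) (𝔼-shifts-suc βs G k) (𝔼-shifts-suc βs G (suc k))

  𝔼-shift-comm : ∀ β γ G k → 𝔼-shift β (𝔼-shift γ G) k ≈ 𝔼-shift γ (𝔼-shift β G) k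
  𝔼-shift-comm β γ G k =
    solve 7 (λ u s v t g₀ g₁ g₂ → u :* (v :* g₀ :+ t :* g₁) :+ s :* (v :* g₁ :+ t :* g₂)
                                := v :* (u :* g₀ :+ s :* g₁) :+ t :* (u :* g₁ :+ s :* g₂)) ≈-refl
      (failure β) (success β) (failure γ) (success γ) (G k) (G (suc k)) (G (suc (suc k)))

  𝔼-shifts-comm : ∀ β βs G k → 𝔼-shift β (𝔼-shifts βs G) k ≈ 𝔼-shifts βs (𝔼-shift β G) k
  𝔼-shifts-comm β []       G k = ≈-refl
  𝔼-shifts-comm β (γ ∷ βs) G k =
    ≈-trans (𝔼-shift-comm β γ (𝔼-shifts βs G) k) (𝔼-shift-cong γ (𝔼-shifts-comm β βs G) k)

  𝔼-shift-mono : ∀ β {x y u v} → x ≤ y → u ≤ v → failure β * x + success β * u ≤ failure β * y + success β * v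
  𝔼-shift-mono β x≤y u≤v =
    +-mono-≤ (*-monoˡ-≤ _ (0≤failure β) x≤y) (*-monoˡ-≤ _ (0≤success β) u≤v)

  𝔼-shift-const : ∀ β x → failure β * x + success β * x ≈ x
  𝔼-shift-const β x = ≈-trans (≈-sym (distribʳ x _ _)) (≈-trans (*-congʳ (sum≈1 β)) (*-identityˡ x))

  𝔼-shifts-nonNegative : ∀ βs {G} → (∀ k → 0# ≤ G k) → ∀ k → 0# ≤ 𝔼-shifts βs G k
  𝔼-shifts-nonNegative []       0≤G k = 0≤G k
  𝔼-shifts-nonNegative (β ∷ βs) 0≤G k =
    +-nonNegative (*-nonNegative (0≤failure β) (𝔼-shifts-nonNegative βs 0≤G k))
                  (*-nonNegative (0≤success β) (𝔼-shifts-nonNegative βs 0≤G (suc k)))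

  𝔼-shifts-≤ : ∀ βs {G x} → (∀ k → G k ≤ x) → ∀ k → 𝔼-shifts βs G k ≤ x
  𝔼-shifts-≤ []       G≤x k = G≤x k
  𝔼-shifts-≤ (β ∷ βs) {x = x} G≤x k =
    ≤-trans (𝔼-shift-mono β (𝔼-shifts-≤ βs G≤x k) (𝔼-shifts-≤ βs G≤x (suc k)))
            (≤-reflexive (𝔼-shift-const β x))

  𝔼-shifts-antitone : ∀ βs {G} → (∀ k → G (suc (suc k)) ≤ G (suc k)) →
    ∀ k → 𝔼-shifts βs G (suc (suc k)) ≤ 𝔼-shifts βs G (suc k)
  𝔼-shifts-antitone []       anti k = anti k
  𝔼-shifts-antitone (β ∷ βs) {G} anti k =
    𝔼-shift-mono β (𝔼-shifts-antitone βs {G} anti k) (𝔼-shifts-antitone βs {G} anti (suc k))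

  -- Writing W = W₁ + … + Wₙ, size-biasing gives
  -- E[W G(W)] = ∑ⱼ rⱼ E[G(1 + W - Wⱼ)] ≥ ∑ⱼ rⱼ E[G(1 + W)].
  mean*𝔼-shifts≤ : ∀ βs {G} → (∀ k → G (suc (suc k)) ≤ G (suc k)) →
    mean βs * 𝔼-shifts βs G 1 ≤ 𝔼-shifts βs (λ k → fromℕ k * G k) 0
  mean*𝔼-shifts≤ []       {G} anti = ≤-reflexive (≈-trans (zeroˡ _) (≈-sym (zeroˡ _)))
  mean*𝔼-shifts≤ (β ∷ βs) {G} anti = begin
    (s + mean βs) * S (𝔼-shifts βs G) 1
      ≈⟨ distribʳ _ s (mean βs) ⟩
    s * S (𝔼-shifts βs G) 1 + mean βs * S (𝔼-shifts βs G) 1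
      -- The variable with law `β` is absorbed into the function, so that the induction hypothesis
      -- applies with `S G` in place of `G`.
      ≈⟨ +-congˡ (*-congˡ (𝔼-shifts-comm β βs G 1)) ⟩
    s * S (𝔼-shifts βs G) 1 + mean βs * 𝔼-shifts βs (S G) 1
      ≤⟨ +-mono-≤ (*-monoˡ-≤ s (0≤success β) shift≤)
           (mean*𝔼-shifts≤ βs {S G} (λ k → 𝔼-shift-mono β (anti k) (anti (suc k)))) ⟩
    s * 𝔼-shifts βs G 1 + 𝔼-shifts βs (λ k → fromℕ k * S G k) 0
      ≈⟨ +-comm _ _ ⟩
    𝔼-shifts βs (λ k → fromℕ k * S G k) 0 + s * 𝔼-shifts βs G 1
      ≡⟨ ≡.cong (λ x → 𝔼-shifts βs (λ k → fromℕ k * S G k) 0 + s * x) (≡.sym (𝔼-shifts-suc βs G 0)) ⟩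
    𝔼-shifts βs (λ k → fromℕ k * S G k) 0 + s * 𝔼-shifts βs (G ∘ suc) 0
      ≈⟨ 𝔼-shifts-linear βs s _ (G ∘ suc) 0 ⟨
    𝔼-shifts βs (λ k → fromℕ k * S G k + s * G (suc k)) 0
      -- For B with law `β` this is n E[G(n + B)] + s G(n + 1) = E[(n + B) G(n + B)], since B
      -- contributes to the factor only when it is 1.
      ≈⟨ 𝔼-shifts-cong βs (λ k → solve 5 (λ n u s g₀ g₁ → n :* (u :* g₀ :+ s :* g₁) :+ s :* g₁
                                          := u :* (n :* g₀) :+ s :* ((con 1 :+ n) :* g₁)) ≈-refl
                                    (fromℕ k) (failure β) s (G k) (G (suc k))) 0 ⟩
    𝔼-shifts βs (S (λ k → fromℕ k * G k)) 0
      ≈⟨ 𝔼-shifts-comm β βs _ 0 ⟨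
    S (𝔼-shifts βs (λ k → fromℕ k * G k)) 0 ∎
    where
    s = success β
    S = 𝔼-shift β

    -- Putting the variable with law `β` back into the argument can only lower a decreasing
    -- function; this is the passage from 1 + W - Wⱼ to 1 + W.
    shift≤ : S (𝔼-shifts βs G) 1 ≤ 𝔼-shifts βs G 1
    shift≤ = ≤-trans (𝔼-shift-mono β ≤-refl (𝔼-shifts-antitone βs {G} anti 0))
                     (≤-reflexive (𝔼-shift-const β _))

  mean*𝔼[1/1+W]≤1 : ∀ βs → mean βs * 𝔼-shifts βs recip 1 ≤ 1#
  mean*𝔼[1/1+W]≤1 βs = ≤-trans (mean*𝔼-shifts≤ βs {recip} recip-antitone) (𝔼-shifts-≤ βs n*recip≤1 0)

-- Opaque, so that sums over it are not expanded into eight terms during unification.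
opaque
  triples : List Triple
  triples = Finite.elements (finite-× {{finite-Bool}} {{finite-× {{finite-Bool}} {{finite-Bool}}}})

xCount yCount size : Triple → ℕ
xCount (x , _ , _)  = bit x
yCount (_ , y , y′) = bit y ℕ.+ bit y′
size t              = xCount t ℕ.+ yCount t

-- One recursion for every weight, so that the counts of X and of Y share the induction in
-- `Fair⇒bound`.
total : (Triple → ℕ) → ∀ {n} → Vec Triple n → ℕ
total w []      = 0
total w (t ∷ v) = w t ℕ.+ total w v

∑X≡total : ∀ {n} (v : Vec Triple n) → ∑X v ≡ total xCount v
∑X≡total []                = ≡.refl
∑X≡total ((x , _ , _) ∷ v) = ≡.cong (bit x ℕ.+_) (∑X≡total v)

∑Y≡total : ∀ {n} (v : Vec Triple n) → ∑Y v ≡ total yCount v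
∑Y≡total []                 = ≡.refl
∑Y≡total ((_ , y , y′) ∷ v) = ≡.cong (bit y ℕ.+ bit y′ ℕ.+_) (∑Y≡total v)

total-size : ∀ {n} (v : Vec Triple n) → total size v ≡ total xCount v ℕ.+ total yCount v
total-size []      = ≡.refl
total-size (t ∷ v) = ≡.trans (≡.cong (size t ℕ.+_) (total-size v))
  (interchange ℕ.+-commutativeSemigroup (xCount t) (yCount t) (total xCount v) (total yCount v))

-- Expectations under a product of laws on triples.

module ProductLaws {c ℓ₁ ℓ₂ : Level} (F : OrderedField c ℓ₁ ℓ₂) where

  open OrderedField F
  open OrderedFieldProperties F
  open Sums F

  Law : Set c
  Law = Triple → Carrier

  -- With iterated sums instead of a sum over vectors, conditioning on the first triple is mere
  -- unfolding, as the inductions over the triples require.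
  E : ∀ {n} → (Fin n → Law) → (Vec Triple n → Carrier) → Carrier
  E {zero}  L g = g []
  E {suc n} L g = ∑ triples (λ t → L zero t * E (L ∘ suc) (λ v → g (t ∷ v)))

  E-cong : ∀ {n} (L : Fin n → Law) {g h} → (∀ v → g v ≈ h v) → E L g ≈ E L h
  E-cong {zero}  L g≈h = g≈h []
  E-cong {suc n} L g≈h = ∑-cong triples (λ t → *-congˡ (E-cong (L ∘ suc) (λ v → g≈h (t ∷ v))))

  E-law-cong : ∀ {n} {L M : Fin n → Law} → (∀ i t → L i t ≈ M i t) → ∀ g → E L g ≈ E M g
  E-law-cong {zero}  L≈M g = ≈-refl
  E-law-cong {suc n} L≈M g =
    ∑-cong triples (λ t → *-cong (L≈M zero t) (E-law-cong (λ i → L≈M (suc i)) (λ v → g (t ∷ v))))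

  E-+ : ∀ {n} (L : Fin n → Law) g h → E L (λ v → g v + h v) ≈ E L g + E L h
  E-+ {zero}  L g h = ≈-refl
  E-+ {suc n} L g h = ≈-trans
    (∑-cong triples (λ t → ≈-trans (*-congˡ (E-+ (L ∘ suc) (λ v → g (t ∷ v)) (λ v → h (t ∷ v)))) (distribˡ _ _ _)))
    (∑-+ triples _ _)

  E-*ˡ : ∀ {n} (L : Fin n → Law) x g → E L (λ v → x * g v) ≈ x * E L g
  E-*ˡ {zero}  L x g = ≈-refl
  E-*ˡ {suc n} L x g = ≈-trans
    (∑-cong triples (λ t → ≈-trans (*-congˡ (E-*ˡ (L ∘ suc) x (λ v → g (t ∷ v))))
      (solve 3 (λ l x e → l :* (x :* e) := x :* (l :* e)) ≈-refl (L zero t) x _)))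
    (∑-*ˡ triples x _)

  E-0 : ∀ {n} (L : Fin n → Law) → E L (λ _ → 0#) ≈ 0#
  E-0 L = ≈-trans (E-cong L (λ _ → ≈-sym (zeroˡ 0#))) (≈-trans (E-*ˡ L 0# (λ _ → 0#)) (zeroˡ _))

  E-∑ : ∀ {n} (L : Fin n → Law) (xs : List A) (g : A → Vec Triple n → Carrier) →
    E L (λ v → ∑ xs (λ x → g x v)) ≈ ∑ xs (λ x → E L (g x))
  E-∑ L []       g = E-0 L
  E-∑ L (x ∷ xs) g = ≈-trans (E-+ L (g x) _) (+-congˡ (E-∑ L xs g))

  E-1 : ∀ {n} (L : Fin n → Law) → (∀ i → ∑ triples (L i) ≈ 1#) → E L (λ _ → 1#) ≈ 1#
  E-1 {zero}  L ∑L≈1 = ≈-refl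
  E-1 {suc n} L ∑L≈1 = ≈-trans
    (∑-cong triples (λ t → ≈-trans (*-congˡ (E-1 (L ∘ suc) (λ i → ∑L≈1 (suc i)))) (*-identityʳ _)))
    (∑L≈1 zero)

  -- The weight is split into that of the first triple and that of the others. For the others the
  -- order of summation is exchanged, so that the first triple is averaged into `G`: what remains is
  -- again a weighted expectation, over one triple fewer and with a new function of the size.
  E-weighted : ∀ {n} (L : Fin (suc n) → Law) w (G : ℕ → Carrier) →
    E L (λ v → fromℕ (total w v) * G (total size v)) ≈
      ∑ triples (λ t → L zero t * (fromℕ (w t) * E (L ∘ suc) (λ v → G (size t ℕ.+ total size v))))
      + E (L ∘ suc) (λ v → fromℕ (total w v) * ∑ triples (λ t → L zero t * G (size t ℕ.+ total size v)))
  E-weighted L w G = begin-equality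
    ∑ triples (λ t → L zero t * E L′ (λ v → fromℕ (w t ℕ.+ total w v) * G (size t ℕ.+ total size v)))
      ≈⟨ ∑-cong triples expand ⟩
    ∑ triples (λ t → own t + rest t)
      ≈⟨ ∑-+ triples own rest ⟩
    ∑ triples own + ∑ triples rest
      ≈⟨ +-congˡ (≈-sym (E-∑ L′ triples _)) ⟩
    ∑ triples own + E L′ (λ v → ∑ triples (λ t → L zero t * (fromℕ (total w v) * G (size t ℕ.+ total size v))))
      ≈⟨ +-congˡ (E-cong L′ (λ v → ≈-trans
           (∑-cong triples (λ t → solve 3 (λ l x e → l :* (x :* e) := x :* (l :* e)) ≈-refl _ _ _))
           (∑-*ˡ triples _ _))) ⟩
    ∑ triples own + E L′ (λ v → fromℕ (total w v) * ∑ triples (λ t → L zero t * G (size t ℕ.+ total size v))) ∎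
    where
    L′ = L ∘ suc
    own rest : Triple → Carrier
    own t  = L zero t * (fromℕ (w t) * E L′ (λ v → G (size t ℕ.+ total size v)))
    rest t = E L′ (λ v → L zero t * (fromℕ (total w v) * G (size t ℕ.+ total size v)))

    expand : ∀ t → L zero t * E L′ (λ v → fromℕ (w t ℕ.+ total w v) * G (size t ℕ.+ total size v)) ≈ own t + rest t
    expand t = begin-equality
      L zero t * E L′ (λ v → fromℕ (w t ℕ.+ total w v) * g v)
        ≈⟨ *-congˡ (E-cong L′ (λ v → ≈-trans (*-congʳ (fromℕ-+ (w t) (total w v))) (distribʳ _ _ _))) ⟩
      L zero t * E L′ (λ v → fromℕ (w t) * g v + fromℕ (total w v) * g v)
        ≈⟨ *-congˡ (E-+ L′ _ _) ⟩
      L zero t * (E L′ (λ v → fromℕ (w t) * g v) + E L′ (λ v → fromℕ (total w v) * g v))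
        ≈⟨ distribˡ _ _ _ ⟩
      L zero t * E L′ (λ v → fromℕ (w t) * g v) + L zero t * E L′ (λ v → fromℕ (total w v) * g v)
        ≈⟨ +-cong (*-congˡ (E-*ˡ L′ _ g)) (≈-sym (E-*ˡ L′ _ _)) ⟩
      own t + rest t ∎
      where
      g : Vec Triple _ → Carrier
      g v = G (size t ℕ.+ total size v)

  E-total : ∀ {n} (L : Fin (suc n) → Law) w → (∀ i → ∑ triples (L i) ≈ 1#) →
    E L (λ v → fromℕ (total w v)) ≈
      ∑ triples (λ t → L zero t * fromℕ (w t)) + E (L ∘ suc) (λ v → fromℕ (total w v))
  E-total L w ∑L≈1 = begin-equality
    E L (λ v → fromℕ (total w v))
      ≈⟨ E-cong L {g = λ v → fromℕ (total w v)} (λ v → ≈-sym (*-identityʳ _)) ⟩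
    E L (λ v → fromℕ (total w v) * 1#)
      ≈⟨ E-weighted L w (λ _ → 1#) ⟩
    ∑ triples (λ t → L zero t * (fromℕ (w t) * E L′ (λ _ → 1#)))
      + E L′ (λ v → fromℕ (total w v) * ∑ triples (λ t → L zero t * 1#))
      ≈⟨ +-cong (∑-cong triples (λ t → *-congˡ (≈-trans (*-congˡ (E-1 L′ (λ i → ∑L≈1 (suc i)))) (*-identityʳ _))))
                (E-cong L′ (λ v → ≈-trans (*-congˡ (≈-trans (∑-cong triples (λ t → *-identityʳ _)) (∑L≈1 zero)))
                                          (*-identityʳ _))) ⟩
    ∑ triples (λ t → L zero t * fromℕ (w t)) + E L′ (λ v → fromℕ (total w v)) ∎
    where L′ = L ∘ suc

-- Bounding the contribution of each triple.

module Bounds {c ℓ₁ ℓ₂ : Level} (F : OrderedField c ℓ₁ ℓ₂) where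

  open OrderedField F
  open OrderedFieldProperties F
  open Sums F
  open BernoulliSums F
  open ProductLaws F

  -- The two cases of the hypothesis on a triple (x , y , y′), up to null events.
  -- In case (b) the variables X and Y′ are thresholds of the same uniform
  -- variable, so one of the events X ∖ Y′ and Y′ ∖ X is null.
  data Kind : Set (c ⊔ ℓ₁ ⊔ ℓ₂) where
    caseA : ∀ u p q → 0# ≤ u → 0# ≤ p → 0# ≤ q → u + (p + q) ≈ 1# → Kind
    caseB : ∀ p r q s → 0# ≤ p → 0# ≤ r → 0# ≤ q → 0# ≤ s →
            (p + q) + (r + s) ≈ 1# → p ≈ 0# ⊎ s ≈ 0# → Kind

  law : Kind → Law
  law (caseA u p q _ _ _ _)         (false , false , false) = u
  law (caseA u p q _ _ _ _)         (true  , false , false) = p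
  law (caseA u p q _ _ _ _)         (false , true  , false) = q
  law (caseB p r q s _ _ _ _ _ _) (true  , false , false) = p
  law (caseB p r q s _ _ _ _ _ _) (true  , false , true)  = r
  law (caseB p r q s _ _ _ _ _ _) (false , true  , false) = q
  law (caseB p r q s _ _ _ _ _ _) (false , true  , true)  = s
  law _                             _                       = 0#

  bernoulli : ∀ {u s} → 0# ≤ u → 0# ≤ s → u + s ≈ 1# → Bernoulli
  bernoulli 0≤u 0≤s sum = record { 0≤failure = 0≤u ; 0≤success = 0≤s ; sum≈1 = sum }

  certain : Bernoulli
  certain = bernoulli ≤-refl 0≤1 (+-identityˡ 1#)

  -- In both cases the size of a triple is a sum of independent Bernoulli variables.
  sizeLaw : Kind → List Bernoulli
  sizeLaw (caseA u p q 0≤u 0≤p 0≤q sum) = bernoulli 0≤u (+-nonNegative 0≤p 0≤q) sum ∷ []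
  sizeLaw (caseB p r q s 0≤p 0≤r 0≤q 0≤s sum _) =
    certain ∷ bernoulli (+-nonNegative 0≤p 0≤q) (+-nonNegative 0≤r 0≤s) sum ∷ []

  opaque
    unfolding triples

    ∑-caseA : ∀ {u p q 0≤u 0≤p 0≤q sum} (h : Triple → Carrier) →
      ∑ triples (λ t → law (caseA u p q 0≤u 0≤p 0≤q sum) t * h t) ≈
        u * h (false , false , false) + (p * h (true , false , false) + q * h (false , true , false))
    ∑-caseA {u} {p} {q} h =
      solve 11 (λ u p q h₁ h₂ h₃ h₄ h₅ h₆ h₇ h₈ →
        u :* h₁ :+ (con 0 :* h₂ :+ (q :* h₃ :+ (con 0 :* h₄ :+ (p :* h₅ :+ (con 0 :* h₆ :+ (con 0 :* h₇ :+ (con 0 :* h₈ :+ con 0)))))))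
        := u :* h₁ :+ (p :* h₅ :+ q :* h₃)) ≈-refl
        u p q (h (false , false , false)) (h (false , false , true)) (h (false , true , false)) (h (false , true , true))
              (h (true , false , false)) (h (true , false , true)) (h (true , true , false)) (h (true , true , true))

    ∑-caseB : ∀ {p r q s 0≤p 0≤r 0≤q 0≤s sum p≈0⊎s≈0} (h : Triple → Carrier) →
      ∑ triples (λ t → law (caseB p r q s 0≤p 0≤r 0≤q 0≤s sum p≈0⊎s≈0) t * h t) ≈
        (p * h (true , false , false) + q * h (false , true , false)) +
        (r * h (true , false , true) + s * h (false , true , true))
    ∑-caseB {p} {r} {q} {s} h =
      solve 12 (λ p r q s h₁ h₂ h₃ h₄ h₅ h₆ h₇ h₈ →
        con 0 :* h₁ :+ (con 0 :* h₂ :+ (q :* h₃ :+ (s :* h₄ :+ (p :* h₅ :+ (r :* h₆ :+ (con 0 :* h₇ :+ (con 0 :* h₈ :+ con 0)))))))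
        := p :* h₅ :+ q :* h₃ :+ (r :* h₆ :+ s :* h₄)) ≈-refl
        p r q s (h (false , false , false)) (h (false , false , true)) (h (false , true , false)) (h (false , true , true))
                (h (true , false , false)) (h (true , false , true)) (h (true , true , false)) (h (true , true , true))

  ∑-size : ∀ κ G k → ∑ triples (λ t → law κ t * G (size t ℕ.+ k)) ≈ 𝔼-shifts (sizeLaw κ) G k
  ∑-size (caseA u p q _ _ _ _) G k = ≈-trans (∑-caseA _)
    (solve 5 (λ u p q g₀ g₁ → u :* g₀ :+ (p :* g₁ :+ q :* g₁) := u :* g₀ :+ (p :+ q) :* g₁) ≈-refl
      u p q (G k) (G (suc k)))
  ∑-size (caseB p r q s _ _ _ _ _ _) G k = ≈-trans (∑-caseB _)
    (solve 7 (λ p r q s g₀ g₁ g₂ → p :* g₁ :+ q :* g₁ :+ (r :* g₂ :+ s :* g₂)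
        := con 0 :* ((p :+ q) :* g₀ :+ (r :+ s) :* g₁) :+ con 1 :* ((p :+ q) :* g₁ :+ (r :+ s) :* g₂)) ≈-refl
      p r q s (G k) (G (suc k)) (G (suc (suc k))))

  ∑-law : ∀ κ → ∑ triples (law κ) ≈ 1#
  ∑-law κ@(caseA _ _ _ _ _ _ sum) = ≈-trans (∑-cong triples (λ t → ≈-sym (*-identityʳ (law κ t))))
    (≈-trans (∑-caseA _) (≈-trans (+-cong (*-identityʳ _) (+-cong (*-identityʳ _) (*-identityʳ _))) sum))
  ∑-law κ@(caseB _ _ _ _ _ _ _ _ sum _) = ≈-trans (∑-cong triples (λ t → ≈-sym (*-identityʳ (law κ t))))
    (≈-trans (∑-caseB _) (≈-trans (+-cong (+-cong (*-identityʳ _) (*-identityʳ _)) (+-cong (*-identityʳ _) (*-identityʳ _))) sum))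

  ∑-size-mean : ∀ κ → ∑ triples (λ t → law κ t * fromℕ (size t)) ≈ mean (sizeLaw κ)
  ∑-size-mean (caseA u p q _ _ _ _) = ≈-trans (∑-caseA _)
    (solve 3 (λ u p q → u :* con 0 :+ (p :* (con 1 :+ con 0) :+ q :* (con 1 :+ con 0)) := p :+ q :+ con 0) ≈-refl u p q)
  -- The full mass p + q + (r + s) is split off; it is the 1 contributed by `certain`.
  ∑-size-mean (caseB p r q s _ _ _ _ sum _) = ≈-trans (∑-caseB _) (≈-trans
    (solve 4 (λ p r q s → p :* (con 1 :+ con 0) :+ q :* (con 1 :+ con 0)
                          :+ (r :* (con 1 :+ (con 1 :+ con 0)) :+ s :* (con 1 :+ (con 1 :+ con 0)))
        := (p :+ q :+ (r :+ s)) :+ (r :+ s :+ con 0)) ≈-refl p r q s)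
    (+-congʳ sum))

  -- `βs` holds independent variables besides the given triples; in `Fair⇒bound` these are the sizes
  -- of the triples already treated.
  sizeLaws : ∀ {n} → (Fin n → Kind) → List Bernoulli → List Bernoulli
  sizeLaws {zero}  κ βs = βs
  sizeLaws {suc n} κ βs = sizeLaw (κ zero) ++ sizeLaws (κ ∘ suc) βs

  E-size : ∀ {n} (κ : Fin n → Kind) βs G k →
    E (law ∘ κ) (λ v → 𝔼-shifts βs G (total size v ℕ.+ k)) ≈ 𝔼-shifts (sizeLaws κ βs) G k
  E-size {zero}  κ βs G k = ≈-refl
  E-size {suc n} κ βs G k = begin-equality
    ∑ triples (λ t → law (κ zero) t * E (law ∘ κ ∘ suc) (λ v → 𝔼-shifts βs G (size t ℕ.+ total size v ℕ.+ k)))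
      ≈⟨ ∑-cong triples (λ t → *-congˡ (≈-trans
           (E-cong (law ∘ κ ∘ suc) (λ v → ≈-reflexive (≡.cong (𝔼-shifts βs G) (move (size t) (total size v)))))
           (E-size (κ ∘ suc) βs G (size t ℕ.+ k)))) ⟩
    ∑ triples (λ t → law (κ zero) t * 𝔼-shifts (sizeLaws (κ ∘ suc) βs) G (size t ℕ.+ k))
      ≈⟨ ∑-size (κ zero) _ k ⟩
    𝔼-shifts (sizeLaw (κ zero)) (𝔼-shifts (sizeLaws (κ ∘ suc) βs) G) k
      ≡⟨ ≡.sym (𝔼-shifts-++ (sizeLaw (κ zero)) _ G k) ⟩
    𝔼-shifts (sizeLaws κ βs) G k ∎
    where
    move : ∀ a b → a ℕ.+ b ℕ.+ k ≡ b ℕ.+ (a ℕ.+ k)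
    move a b = ≡.trans (≡.cong (ℕ._+ k) (ℕ.+-comm a b)) (ℕ.+-assoc b a k)

  mean-sizeLaws : ∀ {n} (κ : Fin n → Kind) βs →
    mean (sizeLaws κ βs) ≈ mean βs + E (law ∘ κ) (λ v → fromℕ (total size v))
  mean-sizeLaws {zero}  κ βs = ≈-sym (+-identityʳ _)
  mean-sizeLaws {suc n} κ βs = begin-equality
    mean (sizeLaw (κ zero) ++ sizeLaws (κ ∘ suc) βs)
      ≈⟨ mean-++ (sizeLaw (κ zero)) _ ⟩
    mean (sizeLaw (κ zero)) + mean (sizeLaws (κ ∘ suc) βs)
      ≈⟨ +-cong (≈-sym (∑-size-mean (κ zero))) (mean-sizeLaws (κ ∘ suc) βs) ⟩
    _ + (mean βs + _)
      ≈⟨ solve 3 (λ a b d → a :+ (b :+ d) := b :+ (a :+ d)) ≈-refl _ _ _ ⟩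
    mean βs + (_ + _)
      ≈⟨ +-congˡ (≈-sym (E-total (law ∘ κ) size (∑-law ∘ κ))) ⟩
    mean βs + E (law ∘ κ) (λ v → fromℕ (total size v)) ∎

  -- D * E[w(t)/(size t + W)] ≤ E[w(t)], where D = E[size t + W] - 1 and W is a
  -- sum of independent Bernoulli variables, independent of t.
  Fair : (Triple → ℕ) → Kind → Set (c ⊔ ℓ₁ ⊔ ℓ₂)
  Fair w κ = ∀ βs D → D + 1# ≈ mean (sizeLaw κ) + mean βs →
    D * ∑ triples (λ t → law κ t * (fromℕ (w t) * 𝔼-shifts βs recip (size t))) ≤
      ∑ triples (λ t → law κ t * fromℕ (w t))

  -- Induction on the number of triples. The first triple is bounded by `fair` against all other
  -- variables; then its `sizeLaw` joins `βs` and the induction continues with the rest. No mean is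
  -- lost in this move, so the same `D` serves every triple.
  Fair⇒bound : ∀ w → (∀ κ → Fair w κ) → ∀ {n} (κ : Fin n → Kind) βs D →
    D + 1# ≈ mean βs + E (law ∘ κ) (λ v → fromℕ (total size v)) →
    D * E (law ∘ κ) (λ v → fromℕ (total w v) * 𝔼-shifts βs recip (total size v)) ≤
      E (law ∘ κ) (λ v → fromℕ (total w v))
  Fair⇒bound w fair {zero}  κ βs D D≈ = ≤-reflexive (≈-trans (*-congˡ (zeroˡ _)) (zeroʳ D))
  Fair⇒bound w fair {suc n} κ βs D D≈ = begin
    D * E (law ∘ κ) (λ v → fromℕ (total w v) * 𝔼-shifts βs recip (total size v))
      ≈⟨ *-congˡ (E-weighted (law ∘ κ) w (𝔼-shifts βs recip)) ⟩
    D * (∑ triples (λ t → law (κ zero) t * (fromℕ (w t) * E L′ (λ v → 𝔼-shifts βs recip (size t ℕ.+ total size v))))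
      + E L′ (λ v → fromℕ (total w v) * ∑ triples (λ t → law (κ zero) t * 𝔼-shifts βs recip (size t ℕ.+ total size v))))
      -- In the first summand the later triples are replaced by the Bernoulli variables making up
      -- their sizes, in the second summand the first triple is.
      ≈⟨ *-congˡ (+-cong (∑-cong triples (λ t → *-congˡ (*-congˡ (≈-trans
           (E-cong L′ (λ v → ≈-reflexive (≡.cong (𝔼-shifts βs recip) (ℕ.+-comm (size t) _))))
           (E-size κ′ βs recip (size t))))))
         (E-cong L′ (λ v → *-congˡ (≈-trans (∑-size (κ zero) _ (total size v))
           (≈-reflexive (≡.sym (𝔼-shifts-++ (sizeLaw (κ zero)) βs recip (total size v)))))))) ⟩
    D * (∑ triples (λ t → law (κ zero) t * (fromℕ (w t) * 𝔼-shifts (sizeLaws κ′ βs) recip (size t)))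
      + E L′ (λ v → fromℕ (total w v) * 𝔼-shifts (sizeLaw (κ zero) ++ βs) recip (total size v)))
      ≈⟨ distribˡ D _ _ ⟩
    _ + _
      ≤⟨ +-mono-≤ (fair (κ zero) (sizeLaws κ′ βs) D here-mean)
                  (Fair⇒bound w fair κ′ (sizeLaw (κ zero) ++ βs) D rest-mean) ⟩
    ∑ triples (λ t → law (κ zero) t * fromℕ (w t)) + E L′ (λ v → fromℕ (total w v))
      ≈⟨ E-total (law ∘ κ) w (∑-law ∘ κ) ⟨
    E (law ∘ κ) (λ v → fromℕ (total w v)) ∎
    where
    κ′ = κ ∘ suc
    L′ = law ∘ κ′

    D≈′ : D + 1# ≈ mean βs + (mean (sizeLaw (κ zero)) + E L′ (λ v → fromℕ (total size v)))
    D≈′ = ≈-trans D≈ (+-congˡ (≈-trans (E-total (law ∘ κ) size (∑-law ∘ κ)) (+-congʳ (∑-size-mean (κ zero)))))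

    here-mean : D + 1# ≈ mean (sizeLaw (κ zero)) + mean (sizeLaws κ′ βs)
    here-mean = ≈-trans D≈′ (≈-trans
      (solve 3 (λ a b d → a :+ (b :+ d) := b :+ (a :+ d)) ≈-refl _ _ _)
      (+-congˡ (≈-sym (mean-sizeLaws κ′ βs))))

    rest-mean : D + 1# ≈ mean (sizeLaw (κ zero) ++ βs) + E L′ (λ v → fromℕ (total size v))
    rest-mean = ≈-trans D≈′ (≈-trans
      (solve 3 (λ a b d → a :+ (b :+ d) := b :+ a :+ d) ≈-refl _ _ _)
      (+-congʳ (≈-sym (mean-++ (sizeLaw (κ zero)) βs))))

  -- With H k = E[1/(k + W)] and D = E[W] + p + q - 1 we have D * H 1 ≤ E[W] * H 1 ≤ 1.
  caseA-bound : ∀ {u p q} → 0# ≤ u → u + (p + q) ≈ 1# → ∀ βs D →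
    D + 1# ≈ (p + q + 0#) + mean βs → D * 𝔼-shifts βs recip 1 ≤ 1#
  caseA-bound {u} {p} {q} 0≤u sum βs D D≈ = ≤-trans
    (*-monoʳ-≤ _ (𝔼-shifts-nonNegative βs recip-nonNegative 1) D≤mean) (mean*𝔼[1/1+W]≤1 βs)
    where
    -- The mean size of the triple is p + q = 1 - u, hence at most 1.
    D≤mean : D ≤ mean βs
    D≤mean = +-cancelʳ-≤ 1# (begin
      D + 1#                       ≤⟨ x≤y+x 0≤u ⟩
      u + (D + 1#)                 ≈⟨ +-congˡ D≈ ⟩
      u + ((p + q + 0#) + mean βs) ≈⟨ solve 4 (λ u p q m → u :+ ((p :+ q :+ con 0) :+ m) := m :+ (u :+ (p :+ q))) ≈-refl u p q (mean βs) ⟩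
      mean βs + (u + (p + q))      ≈⟨ +-congˡ sum ⟩
      mean βs + 1#                 ∎)

  -- Likewise D ≤ E[1 + W] gives D * H 2 ≤ 1, and D = E[B + W] gives D * E[1/(1 + B + W)] ≤ 1.
  caseB-bounds : ∀ β βs D → D + 1# ≈ (1# + (Bernoulli.success β + 0#)) + mean βs →
    let H₁ = 𝔼-shifts βs recip 1 ; H₂ = 𝔼-shifts βs recip 2 in
    D * H₂ ≤ 1# × Bernoulli.failure β * (D * H₁) + Bernoulli.success β * (D * H₂) ≤ 1#
  caseB-bounds β βs D D≈ =
    (begin
      D * H₂                              ≤⟨ *-monoʳ-≤ H₂ (0≤H 2) D≤1+m ⟩
      -- `H₂` is E[1/(1 + (1 + W))], so the size-biasing bound is used for the list `certain ∷ βs`,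
      -- whose mean is 1 + m.
      (1# + m) * H₂                       ≈⟨ *-congˡ (solve 2 (λ g₁ g₂ → g₂ := con 0 :* g₁ :+ con 1 :* g₂) ≈-refl H₁ H₂) ⟩
      (1# + m) * (0# * H₁ + 1# * H₂)      ≤⟨ mean*𝔼[1/1+W]≤1 (certain ∷ βs) ⟩
      1#                                  ∎) ,
    (begin
      u * (D * H₁) + s * (D * H₂)         ≈⟨ solve 5 (λ u s D g₁ g₂ → u :* (D :* g₁) :+ s :* (D :* g₂) := D :* (u :* g₁ :+ s :* g₂)) ≈-refl u s D H₁ H₂ ⟩
      D * 𝔼-shifts (β ∷ βs) recip 1       ≤⟨ *-monoʳ-≤ _ (𝔼-shifts-nonNegative (β ∷ βs) recip-nonNegative 1) D≤s+m ⟩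
      (s + m) * 𝔼-shifts (β ∷ βs) recip 1 ≤⟨ mean*𝔼[1/1+W]≤1 (β ∷ βs) ⟩
      1#                                  ∎)
    where
    open Bernoulli β renaming (failure to u; success to s)
    m  = mean βs
    H₁ = 𝔼-shifts βs recip 1
    H₂ = 𝔼-shifts βs recip 2
    0≤H = 𝔼-shifts-nonNegative βs recip-nonNegative

    D≤s+m : D ≤ s + m
    D≤s+m = +-cancelʳ-≤ 1# (≤-reflexive (≈-trans D≈
      (solve 2 (λ s m → con 1 :+ (s :+ con 0) :+ m := s :+ m :+ con 1) ≈-refl s m)))

    D≤1+m : D ≤ 1# + m
    D≤1+m = ≤-trans D≤s+m (+-monoˡ-≤ m (≤-trans (x≤y+x 0≤failure) (≤-reflexive sum≈1)))

  weights≤ : ∀ {a b x y} → 0# ≤ a → 0# ≤ b → x ≤ 1# → y ≤ 1# → a * x + b * y ≤ a + b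
  weights≤ {a} {b} 0≤a 0≤b x≤1 y≤1 = +-mono-≤
    (≤-trans (*-monoˡ-≤ a 0≤a x≤1) (≤-reflexive (*-identityʳ a)))
    (≤-trans (*-monoˡ-≤ b 0≤b y≤1) (≤-reflexive (*-identityʳ b)))

  -- If x ≤ 1 there is nothing to prove; otherwise moving the weight b from x
  -- to 1 only decreases the left-hand side of the hypothesis.
  drop-weight : ∀ {a b d x y} → 0# ≤ a → 0# ≤ b → 0# ≤ d → y ≤ 1# → (a + b) + d ≈ 1# →
    (a + b) * x + d * y ≤ 1# → a * x + d * y ≤ a + d
  drop-weight {a} {b} {d} {x} {y} 0≤a 0≤b 0≤d y≤1 sum avg≤1 with ≤-total x 1#
  ... | inj₁ x≤1 = weights≤ 0≤a 0≤d x≤1 y≤1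
  ... | inj₂ 1≤x = +-cancelʳ-≤ b (begin
    a * x + d * y + b        ≈⟨ +-congˡ (*-identityʳ b) ⟨
    a * x + d * y + b * 1#   ≤⟨ +-mono-≤ ≤-refl (*-monoˡ-≤ b 0≤b 1≤x) ⟩
    a * x + d * y + b * x    ≈⟨ solve 5 (λ a b d x y → a :* x :+ d :* y :+ b :* x := (a :+ b) :* x :+ d :* y) ≈-refl a b d x y ⟩
    (a + b) * x + d * y      ≤⟨ avg≤1 ⟩
    1#                       ≈⟨ sum ⟨
    a + b + d                ≈⟨ solve 3 (λ a b d → a :+ b :+ d := a :+ d :+ b) ≈-refl a b d ⟩
    a + d + b                ∎)

  fair-x : ∀ κ → Fair xCount κ
  fair-x (caseA u p q 0≤u 0≤p 0≤q sum) βs D D≈ = begin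
    D * _              ≈⟨ *-congˡ (∑-caseA {sum = sum} _) ⟩
    D * (u * (0# * H 0) + (p * ((1# + 0#) * H 1) + q * (0# * H 1)))
      ≈⟨ solve 6 (λ D u p q h₀ h₁ → D :* (u :* (con 0 :* h₀) :+ (p :* ((con 1 :+ con 0) :* h₁) :+ q :* (con 0 :* h₁)))
                   := p :* (D :* h₁)) ≈-refl D u p q (H 0) (H 1) ⟩
    p * (D * H 1)      ≤⟨ *-monoˡ-≤ p 0≤p (caseA-bound 0≤u sum βs D D≈) ⟩
    p * 1#
      ≈⟨ solve 3 (λ u p q → p :* con 1 := u :* con 0 :+ (p :* (con 1 :+ con 0) :+ q :* con 0)) ≈-refl u p q ⟩
    u * 0# + (p * (1# + 0#) + q * 0#)   ≈⟨ ∑-caseA {0≤u = 0≤u} {0≤p} {0≤q} {sum} (λ t → fromℕ (xCount t)) ⟨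
    _                  ∎
    where H = 𝔼-shifts βs recip
  fair-x (caseB p r q s 0≤p 0≤r 0≤q 0≤s sum p≈0⊎s≈0) βs D D≈ = begin
    D * _              ≈⟨ *-congˡ (∑-caseB {sum = sum} {p≈0⊎s≈0} _) ⟩
    D * ((p * ((1# + 0#) * H 1) + q * (0# * H 1)) + (r * ((1# + 0#) * H 2) + s * (0# * H 2)))
      ≈⟨ solve 7 (λ D p r q s h₁ h₂ →
           D :* ((p :* ((con 1 :+ con 0) :* h₁) :+ q :* (con 0 :* h₁)) :+ (r :* ((con 1 :+ con 0) :* h₂) :+ s :* (con 0 :* h₂)))
             := p :* (D :* h₁) :+ r :* (D :* h₂)) ≈-refl D p r q s (H 1) (H 2) ⟩
    p * (D * H 1) + r * (D * H 2)       ≤⟨ nested p≈0⊎s≈0 ⟩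
    p + r
      ≈⟨ solve 4 (λ p r q s → p :+ r := (p :* (con 1 :+ con 0) :+ q :* con 0) :+ (r :* (con 1 :+ con 0) :+ s :* con 0))
           ≈-refl p r q s ⟩
    (p * (1# + 0#) + q * 0#) + (r * (1# + 0#) + s * 0#)
      ≈⟨ ∑-caseB {0≤p = 0≤p} {0≤r} {0≤q} {0≤s} {sum} {p≈0⊎s≈0} (λ t → fromℕ (xCount t)) ⟨
    _                  ∎
    where
    H = 𝔼-shifts βs recip
    β = bernoulli (+-nonNegative 0≤p 0≤q) (+-nonNegative 0≤r 0≤s) sum
    DH₂≤1 = proj₁ (caseB-bounds β βs D D≈)
    avg≤1 = proj₂ (caseB-bounds β βs D D≈)

    nested : p ≈ 0# ⊎ s ≈ 0# → p * (D * H 1) + r * (D * H 2) ≤ p + r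
    nested (inj₁ p≈0) = +-mono-≤
      (≤-reflexive (≈-trans (*-congʳ p≈0) (≈-trans (zeroˡ _) (≈-sym p≈0))))
      (≤-trans (*-monoˡ-≤ r 0≤r DH₂≤1) (≤-reflexive (*-identityʳ r)))
    -- Now r + s = r, so the averaged bound has weights p + q and r; dropping q, the mass of Y
    -- without Y′, leaves exactly the mass of X.
    nested (inj₂ s≈0) = drop-weight 0≤p 0≤q 0≤r DH₂≤1 (≈-trans (+-congˡ (≈-sym r+s≈r)) sum)
      (≤-trans (≤-reflexive (+-congˡ (*-congʳ (≈-sym r+s≈r)))) avg≤1)
      where
      r+s≈r : r + s ≈ r
      r+s≈r = ≈-trans (+-congˡ s≈0) (+-identityʳ r)

  -- In case (b) the outcome with Y and Y′ both 1 counts twice. One copy of its mass `s` belongs to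
  -- the averaged bound, from which `p` is dropped; the other copy is covered by `D * H 2 ≤ 1`.
  fair-y : ∀ κ → Fair yCount κ
  fair-y (caseA u p q 0≤u 0≤p 0≤q sum) βs D D≈ = begin
    D * _              ≈⟨ *-congˡ (∑-caseA {sum = sum} _) ⟩
    D * (u * (0# * H 0) + (p * (0# * H 1) + q * ((1# + 0#) * H 1)))
      ≈⟨ solve 6 (λ D u p q h₀ h₁ → D :* (u :* (con 0 :* h₀) :+ (p :* (con 0 :* h₁) :+ q :* ((con 1 :+ con 0) :* h₁)))
                   := q :* (D :* h₁)) ≈-refl D u p q (H 0) (H 1) ⟩
    q * (D * H 1)      ≤⟨ *-monoˡ-≤ q 0≤q (caseA-bound 0≤u sum βs D D≈) ⟩
    q * 1#
      ≈⟨ solve 3 (λ u p q → q :* con 1 := u :* con 0 :+ (p :* con 0 :+ q :* (con 1 :+ con 0))) ≈-refl u p q ⟩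
    u * 0# + (p * 0# + q * (1# + 0#))   ≈⟨ ∑-caseA {0≤u = 0≤u} {0≤p} {0≤q} {sum} (λ t → fromℕ (yCount t)) ⟨
    _                  ∎
    where H = 𝔼-shifts βs recip
  fair-y (caseB p r q s 0≤p 0≤r 0≤q 0≤s sum p≈0⊎s≈0) βs D D≈ = begin
    D * _              ≈⟨ *-congˡ (∑-caseB {sum = sum} {p≈0⊎s≈0} _) ⟩
    D * ((p * (0# * H 1) + q * ((1# + 0#) * H 1)) + (r * ((1# + 0#) * H 2) + s * ((1# + (1# + 0#)) * H 2)))
      ≈⟨ solve 7 (λ D p r q s h₁ h₂ →
           D :* ((p :* (con 0 :* h₁) :+ q :* ((con 1 :+ con 0) :* h₁))
                 :+ (r :* ((con 1 :+ con 0) :* h₂) :+ s :* ((con 1 :+ (con 1 :+ con 0)) :* h₂)))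
             := (q :* (D :* h₁) :+ (r :+ s) :* (D :* h₂)) :+ s :* (D :* h₂)) ≈-refl D p r q s (H 1) (H 2) ⟩
    (q * (D * H 1) + (r + s) * (D * H 2)) + s * (D * H 2)
      ≤⟨ +-mono-≤ (drop-weight 0≤q 0≤p (+-nonNegative 0≤r 0≤s) DH₂≤1 (≈-trans (+-congʳ (+-comm q p)) sum)
                    (≤-trans (≤-reflexive (+-congʳ (*-congʳ (+-comm q p)))) avg≤1))
                  (*-monoˡ-≤ s 0≤s DH₂≤1) ⟩
    (q + (r + s)) + s * 1#
      ≈⟨ solve 4 (λ p r q s → (q :+ (r :+ s)) :+ s :* con 1
           := (p :* con 0 :+ q :* (con 1 :+ con 0)) :+ (r :* (con 1 :+ con 0) :+ s :* (con 1 :+ (con 1 :+ con 0))))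
           ≈-refl p r q s ⟩
    (p * 0# + q * (1# + 0#)) + (r * (1# + 0#) + s * (1# + (1# + 0#)))
      ≈⟨ ∑-caseB {0≤p = 0≤p} {0≤r} {0≤q} {0≤s} {sum} {p≈0⊎s≈0} (λ t → fromℕ (yCount t)) ⟨
    _                  ∎
    where
    H = 𝔼-shifts βs recip
    β = bernoulli (+-nonNegative 0≤p 0≤q) (+-nonNegative 0≤r 0≤s) sum
    DH₂≤1 = proj₁ (caseB-bounds β βs D D≈)
    avg≤1 = proj₂ (caseB-bounds β βs D D≈)

-- Enumerations and decidable tests.

complete⇒↭ : {xs ys : List A} → Unique xs → Unique ys → (∀ x → x ∈ xs) → (∀ x → x ∈ ys) → xs ↭ ys
complete⇒↭ xs! ys! ∈xs ∈ys = ∼bag⇒↭ (unique∧set⇒bag xs! ys! (mk⇔ (λ _ → ∈ys _) (λ _ → ∈xs _)))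

does-×≟ : (_≟₁_ : DecidableEquality A) (_≟₂_ : DecidableEquality B) → ∀ x y {z w} →
  does (×-≡-dec _≟₁_ _≟₂_ (x , z) (y , w)) ≡ does (x ≟₁ y) ∧ does (z ≟₂ w)
does-×≟ _≟₁_ _≟₂_ x y with x ≟₁ y
... | no _       = ≡.refl
... | yes ≡.refl = ≡.refl

does-⇒ : (A? : Dec A) (B? : Dec B) → (A → B) → does A? ∧ not (does B?) ≡ false
does-⇒ (no _)  _       A⇒B = ≡.refl
does-⇒ (yes _) (yes _) A⇒B = ≡.refl
does-⇒ (yes a) (no ¬b) A⇒B = ⊥-elim (¬b (A⇒B a))

-- From the probability space to a product of laws.

module ProbabilityProperties {c ℓ₁ ℓ₂ o m : Level} (F : OrderedField c ℓ₁ ℓ₂) (S : ProbabilitySpace F o m) where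

  open OrderedField F
  open ProbabilitySpace S
  open Probability F S
  open OrderedFieldProperties F
  open Sums F
  open ProductLaws F
  open Bounds F

  measurable-∅ : Measurable (λ _ → false)
  measurable-∅ = measurable-∁ measurable-Ω

  measurable-∪ : ∀ {A B} → Measurable A → Measurable B → Measurable (λ ω → A ω ∨ B ω)
  measurable-∪ {A} {B} mA mB = measurable-cong (λ ω → de-morgan (A ω) (B ω))
    (measurable-∁ (measurable-∩ (measurable-∁ mA) (measurable-∁ mB)))
    where
    de-morgan : ∀ x y → not (not x ∧ not y) ≡ x ∨ y
    de-morgan true  y = ≡.refl
    de-morgan false y = Bool.not-involutive y

  ℙ-split : ∀ {A B} → Measurable A → Measurable B → ℙ A ≈ ℙ (λ ω → A ω ∧ B ω) + ℙ (λ ω → A ω ∧ not (B ω))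
  ℙ-split {A} {B} mA mB = ≈-trans (ℙ-cong (λ ω → cover (A ω) (B ω)))
    (ℙ-additive (measurable-∩ mA mB) (measurable-∩ mA (measurable-∁ mB)) (λ ω → disjoint (A ω) (B ω)))
    where
    cover : ∀ x y → x ≡ (x ∧ y) ∨ (x ∧ not y)
    cover true  true  = ≡.refl
    cover true  false = ≡.refl
    cover false y     = ≡.refl

    disjoint : ∀ x y → (x ∧ y) ∧ (x ∧ not y) ≡ false
    disjoint true  true  = ≡.refl
    disjoint true  false = ≡.refl
    disjoint false y     = ≡.refl

  ℙ-∅ : ℙ (λ _ → false) ≈ 0#
  ℙ-∅ = antisym (+-cancelʳ-≤ (ℙ (λ _ → false)) (≤-reflexive (≈-trans
      (≈-sym (ℙ-additive measurable-∅ measurable-∅ (λ _ → ≡.refl))) (≈-sym (+-identityˡ _)))))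
    (ℙ-nonNeg measurable-∅)

  ℙ-null : ∀ {A B} → Measurable A → Measurable B → (∀ ω → B ω ∧ A ω ≡ A ω) → ℙ B ≈ 0# → ℙ A ≈ 0#
  ℙ-null mA mB A⊆B ℙB≈0 = ≈-trans (ℙ-cong (λ ω → ≡.sym (A⊆B ω)))
    (x+y≈0⇒x≈0 (ℙ-nonNeg (measurable-∩ mB mA)) (ℙ-nonNeg (measurable-∩ mB (measurable-∁ mA)))
      (≈-trans (≈-sym (ℙ-split mB mA)) ℙB≈0))

  module _ (_≟_ : DecidableEquality A) where

    occurs : A → List A → Bool
    occurs x = List.foldr (λ y b → does (x ≟ y) ∨ b) false

    ∈⇒occurs : ∀ {x xs} → x ∈ xs → occurs x xs ≡ true
    ∈⇒occurs {x} (here {x = y} x≡y) rewrite dec-true (x ≟ y) x≡y = ≡.refl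
    ∈⇒occurs {x} (there {x = y} x∈xs) rewrite ∈⇒occurs x∈xs = Bool.∨-zeroʳ (does (x ≟ y))

    ∉⇒¬occurs : ∀ {x xs} → All (x ≢_) xs → occurs x xs ≡ false
    ∉⇒¬occurs         []           = ≡.refl
    ∉⇒¬occurs {x} (_∷_ {x = y} x≢y x∉xs) rewrite dec-false (x ≟ y) x≢y = ∉⇒¬occurs x∉xs

    module _ (Z : Ω → A) (mZ : ∀ x → Measurable (λ ω → does (Z ω ≟ x))) where

      measurable-occurs : ∀ xs → Measurable (λ ω → occurs (Z ω) xs)
      measurable-occurs []       = measurable-∅
      measurable-occurs (x ∷ xs) = measurable-∪ (mZ x) (measurable-occurs xs)

      -- Additivity along the list; the absence of repetitions makes the events disjoint.
      ∑ℙ≈ℙ-occurs : ∀ {xs} → Unique xs → ∑ xs (λ x → ℙ (λ ω → does (Z ω ≟ x))) ≈ ℙ (λ ω → occurs (Z ω) xs)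
      ∑ℙ≈ℙ-occurs []                          = ≈-sym ℙ-∅
      ∑ℙ≈ℙ-occurs {x ∷ xs} (x∉xs ∷ xs!) = ≈-trans (+-congˡ (∑ℙ≈ℙ-occurs xs!))
        (≈-sym (ℙ-additive (mZ x) (measurable-occurs xs) disjoint))
        where
        disjoint : ∀ ω → does (Z ω ≟ x) ∧ occurs (Z ω) xs ≡ false
        disjoint ω with Z ω ≟ x
        ... | no  _    = ≡.refl
        ... | yes Zω≡x = ≡.trans (≡.cong (λ z → occurs z xs) Zω≡x) (∉⇒¬occurs x∉xs)

      ∑ℙ≈1 : ∀ {xs} → Unique xs → (∀ x → x ∈ xs) → ∑ xs (λ x → ℙ (λ ω → does (Z ω ≟ x))) ≈ 1#
      ∑ℙ≈1 xs! ∈xs = ≈-trans (∑ℙ≈ℙ-occurs xs!) (≈-trans (ℙ-cong (λ ω → ∈⇒occurs (∈xs (Z ω)))) ℙ-Ω)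

  private
    fin : Finite Triple
    fin = finite-× {{finite-Bool}} {{finite-× {{finite-Bool}} {{finite-Bool}}}}

    finVec : ∀ n → Finite (Vec Triple n)
    finVec n = finite-Vec {n = n} {{fin}}

  lawOf : (Ω → Triple) → Law
  lawOf Z t = ℙ (λ ω → does (Finite._≟_ fin (Z ω) t))

  weight : ∀ {n} → (Fin n → Law) → Vec Triple n → Carrier
  weight L v = Vector.foldr _*_ 1# (λ i → L i (lookup v i))

  opaque
    unfolding triples

    ∑-weight : ∀ n (L : Fin n → Law) g → ∑ (Finite.elements (finVec n)) (λ v → g v * weight L v) ≈ E L g
    ∑-weight zero    L g = ≈-trans (+-identityʳ _) (*-identityʳ _)
    ∑-weight (suc n) L g = begin-equality
      ∑ (Finite.elements (finVec (suc n))) (λ v → g v * weight L v)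
        -- The enumeration inside `finite-Vec` is local to a fixed length, so that of length `suc n`
        -- does not unfold to the one of length `n`. Both lists are complete and free of
        -- repetitions, hence permutations of each other.
        ≈⟨ ∑-↭ _ (complete⇒↭ (Finite.unique (finVec (suc n)))
             (cartesianProductWith⁺ _∷_ ∷-injective (Finite.unique fin) (Finite.unique (finVec n)))
             (Finite.complete (finVec (suc n)))
             (λ { (t ∷ v) → ∈-cartesianProductWith⁺ _∷_ (Finite.complete fin t) (Finite.complete (finVec n) v) })) ⟩
      ∑ (cartesianProductWith _∷_ triples (Finite.elements (finVec n))) (λ v → g v * weight L v)
        ≈⟨ ∑-cartesianProductWith _∷_ triples (Finite.elements (finVec n)) _ ⟩
      ∑ triples (λ t → ∑ (Finite.elements (finVec n)) (λ v → g (t ∷ v) * (L zero t * weight (L ∘ suc) v)))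
        ≈⟨ ∑-cong triples (λ t → ≈-trans
             (≈-trans (∑-cong (Finite.elements (finVec n)) (λ v →
                solve 3 (λ x l y → x :* (l :* y) := l :* (x :* y)) ≈-refl (g (t ∷ v)) (L zero t) (weight (L ∘ suc) v)))
              (∑-*ˡ (Finite.elements (finVec n)) (L zero t) (λ v → g (t ∷ v) * weight (L ∘ suc) v)))
             (*-congˡ (∑-weight n (L ∘ suc) (λ v → g (t ∷ v))))) ⟩
      ∑ triples (λ t → L zero t * E (L ∘ suc) (λ v → g (t ∷ v))) ∎

    ∑-lawOf : ∀ Z → (∀ t → Measurable (λ ω → does (Finite._≟_ fin (Z ω) t))) → ∑ triples (lawOf Z) ≈ 1#
    ∑-lawOf Z mZ = ∑ℙ≈1 (Finite._≟_ fin) Z mZ (Finite.unique fin) (Finite.complete fin)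

    ∑-triples : ∀ L → ∑ triples L ≈
      L (false , false , false) + (L (false , false , true) + (L (false , true , false) + (L (false , true , true)
      + (L (true , false , false) + (L (true , false , true) + (L (true , true , false) + (L (true , true , true) + 0#)))))))
    ∑-triples L = ≈-refl

  -- Independence is applied to singletons: if `B i` tests equality with the i-th entry of `v`, the
  -- probability of `v` factors into `weight`.
  𝔼≈E : ∀ {n} (Z : Fin n → Ω → Triple) → Independent Z → ∀ g →
    𝔼 (λ ω → tabulate (λ i → Z i ω)) g ≈ E (lawOf ∘ Z) g
  𝔼≈E {n} Z ind g = ≈-trans
    (∑-cong (Finite.elements (finVec n)) (λ v → *-congˡ {g v} (≈-trans (ℙ-cong (λ ω → same (λ i → Z i ω) v))
      (ind (λ i t → does (Finite._≟_ fin t (lookup v i)))))))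
    (∑-weight n (lawOf ∘ Z) g)
    where
    same : ∀ {k} (z : Fin k → Triple) v → does (Finite._≟_ (finVec k) (tabulate z) v) ≡
      Vector.foldr _∧_ true (λ i → does (Finite._≟_ fin (z i) (lookup v i)))
    same z []      = ≡.refl
    same z (t ∷ v) = ≡.cong (does (Finite._≟_ fin (z zero) t) ∧_) (same (z ∘ suc) v)

  𝔼-bit : ∀ (V : Ω → Bool) → 𝔼 V (λ x → fromℕ (bit x)) ≈ ℙ V
  𝔼-bit V = ≈-trans
    (solve 2 (λ x y → con 0 :* x :+ ((con 1 :+ con 0) :* y :+ con 0) := y) ≈-refl
      (ℙ (λ ω → does (V ω Bool.≟ false))) (ℙ (λ ω → does (V ω Bool.≟ true))))
    (ℙ-cong (λ ω → ≟-true (V ω)))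
    where
    ≟-true : ∀ x → does (x Bool.≟ true) ≡ x
    ≟-true true  = ≡.refl
    ≟-true false = ≡.refl

  𝔼-bit*bit : ∀ (V W : Ω → Bool) → 𝔼 (λ ω → (V ω , W ω)) (λ (x , y) → fromℕ (bit x ℕ.* bit y)) ≈ ℙ (λ ω → V ω ∧ W ω)
  𝔼-bit*bit V W = ≈-trans
    (solve 4 (λ w x y z → con 0 :* w :+ (con 0 :* x :+ (con 0 :* y :+ ((con 1 :+ con 0) :* z :+ con 0))) := z) ≈-refl
      (at false false) (at false true) (at true false) (at true true))
    (ℙ-cong (λ ω → ≟-true (V ω) (W ω)))
    where
    at : Bool → Bool → Carrier
    at x y = ℙ (λ ω → does (Finite._≟_ (finite-× {{finite-Bool}} {{finite-Bool}}) (V ω , W ω) (x , y)))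

    ≟-true : ∀ x y → does (Finite._≟_ (finite-× {{finite-Bool}} {{finite-Bool}}) (x , y) (true , true)) ≡ x ∧ y
    ≟-true true  true  = ≡.refl
    ≟-true true  false = ≡.refl
    ≟-true false y     = ≡.refl

  measurable-≟ : ∀ {V} → Measurable V → ∀ b → Measurable (λ ω → does (V ω Bool.≟ b))
  measurable-≟ {V} mV true  = measurable-cong (λ ω → lemma (V ω)) mV
    where
    lemma : ∀ x → x ≡ does (x Bool.≟ true)
    lemma true  = ≡.refl
    lemma false = ≡.refl
  measurable-≟ {V} mV false = measurable-cong (λ ω → lemma (V ω)) (measurable-∁ mV)
    where
    lemma : ∀ x → not x ≡ does (x Bool.≟ false)
    lemma true  = ≡.refl
    lemma false = ≡.refl

  module _ {X Y Y′ : Ω → Bool} (mX : Measurable X) (mY : Measurable Y) (mY′ : Measurable Y′)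
           (ℙXY≈0 : ℙ (λ ω → X ω ∧ Y ω) ≈ 0#) where

    private
      Z : Ω → Triple
      Z ω = X ω , Y ω , Y′ ω

      L : Law
      L = lawOf Z

    measurable-triple : ∀ t → Measurable (λ ω → does (Finite._≟_ fin (Z ω) t))
    measurable-triple (x , y , y′) = measurable-cong same
      (measurable-∩ (measurable-≟ mX x) (measurable-∩ (measurable-≟ mY y) (measurable-≟ mY′ y′)))
      where
      same : ∀ ω → does (X ω Bool.≟ x) ∧ (does (Y ω Bool.≟ y) ∧ does (Y′ ω Bool.≟ y′)) ≡ does (Finite._≟_ fin (Z ω) (x , y , y′))
      same ω = ≡.sym (≡.trans (does-×≟ Bool._≟_ _ (X ω) x)
        (≡.cong (does (X ω Bool.≟ x) ∧_) (does-×≟ Bool._≟_ Bool._≟_ (Y ω) y)))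

    0≤L : ∀ t → 0# ≤ L t
    0≤L t = ℙ-nonNeg (measurable-triple t)

    null⇒L≈0 : (B : Triple → Bool) → Measurable (B ∘ Z) → ℙ (B ∘ Z) ≈ 0# → ∀ t → B t ≡ true → L t ≈ 0#
    null⇒L≈0 B mB ℙB≈0 t Bt = ℙ-null (measurable-triple t) mB covered ℙB≈0
      where
      covered : ∀ ω → B (Z ω) ∧ does (Finite._≟_ fin (Z ω) t) ≡ does (Finite._≟_ fin (Z ω) t)
      covered ω with Finite._≟_ fin (Z ω) t
      ... | no  _    = Bool.∧-zeroʳ (B (Z ω))
      ... | yes Zω≡t = ≡.trans (Bool.∧-identityʳ _) (≡.trans (≡.cong B Zω≡t) Bt)

    xy-null : ∀ y′ → L (true , true , y′) ≈ 0#
    xy-null y′ = null⇒L≈0 (λ { (x , y , _) → x ∧ y }) (measurable-∩ mX mY) ℙXY≈0 (true , true , y′) ≡.refl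

    -- Outcomes with Y′ = 1 and outcomes with X = Y = 1 are null, which leaves three atoms.
    kindA : ℙ Y′ ≈ 0# → Σ[ κ ∈ Kind ] (∀ t → L t ≈ law κ t)
    kindA ℙY′≈0 = caseA u p q (0≤L _) (0≤L _) (0≤L _) sum , agree
      where
      u = L (false , false , false)
      p = L (true , false , false)
      q = L (false , true , false)

      y′-null : ∀ x y → L (x , y , true) ≈ 0#
      y′-null x y = null⇒L≈0 (λ { (_ , _ , y′) → y′ }) mY′ ℙY′≈0 (x , y , true) ≡.refl

      sum : u + (p + q) ≈ 1#
      sum = begin-equality
        u + (p + q)
          ≈⟨ solve 3 (λ u p q → u :+ (p :+ q) :=
               u :+ (con 0 :+ (q :+ (con 0 :+ (p :+ (con 0 :+ (con 0 :+ (con 0 :+ con 0)))))))) ≈-refl u p q ⟩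
        u + (0# + (q + (0# + (p + (0# + (0# + (0# + 0#)))))))
          ≈⟨ +-congˡ (+-cong (≈-sym (y′-null false false)) (+-congˡ (+-cong (≈-sym (y′-null false true))
               (+-congˡ (+-cong (≈-sym (y′-null true false)) (+-cong (≈-sym (xy-null false))
                 (+-congʳ (≈-sym (xy-null true))))))))) ⟩
        _           ≈⟨ ∑-triples L ⟨
        ∑ triples L ≈⟨ ∑-lawOf Z measurable-triple ⟩
        1#          ∎

      agree : ∀ t → L t ≈ law (caseA u p q (0≤L _) (0≤L _) (0≤L _) sum) t
      agree (false , false , false) = ≈-refl
      agree (false , false , true)  = y′-null false false
      agree (false , true  , false) = ≈-refl
      agree (false , true  , true)  = y′-null false true
      agree (true  , false , false) = ≈-refl
      agree (true  , false , true)  = y′-null true false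
      agree (true  , true  , false) = xy-null false
      agree (true  , true  , true)  = xy-null true

    -- X and Y overlap in a null event and their probabilities add up to 1, so their union has
    -- probability 1.
    neither-null : ℙ Y ≈ 1# - ℙ X → ℙ (λ ω → not (X ω) ∧ not (Y ω)) ≈ 0#
    neither-null ℙY≈1-ℙX = antisym (+-cancelʳ-≤ 1# (≤-reflexive (begin-equality
      N + 1#                                   ≈⟨ +-congˡ (≈-sym ℙX+ℙY≈1) ⟩
      N + (ℙ X + ℙ Y)                          ≈⟨ +-congˡ (+-cong X-split Y-split) ⟩
      N + (X∖Y + Y∖X)                          ≈⟨ solve 3 (λ n x y → n :+ (x :+ y) := x :+ (y :+ n)) ≈-refl N X∖Y Y∖X ⟩
      X∖Y + (Y∖X + N)                          ≈⟨ +-congʳ X-split ⟨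
      ℙ X + (Y∖X + N)                          ≈⟨ +-congˡ (≈-sym (ℙ-split (measurable-∁ mX) mY)) ⟩
      ℙ X + ℙ (λ ω → not (X ω))                ≈⟨ ℙ-split measurable-Ω mX ⟨
      ℙ (λ _ → true)                           ≈⟨ ℙ-Ω ⟩
      1#                                       ≈⟨ +-identityˡ 1# ⟨
      0# + 1#                                  ∎)))
      (ℙ-nonNeg (measurable-∩ (measurable-∁ mX) (measurable-∁ mY)))
      where
      N   = ℙ (λ ω → not (X ω) ∧ not (Y ω))
      X∖Y = ℙ (λ ω → X ω ∧ not (Y ω))
      Y∖X = ℙ (λ ω → not (X ω) ∧ Y ω)

      ℙX+ℙY≈1 : ℙ X + ℙ Y ≈ 1#
      ℙX+ℙY≈1 = ≈-trans (+-congˡ (≈-trans ℙY≈1-ℙX (+-comm 1# _)))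
        (≈-trans (≈-sym (+-assoc _ _ _)) (≈-trans (+-congʳ (-‿inverseʳ (ℙ X))) (+-identityˡ 1#)))

      X-split : ℙ X ≈ X∖Y
      X-split = ≈-trans (ℙ-split mX mY) (≈-trans (+-congʳ ℙXY≈0) (+-identityˡ _))

      Y-split : ℙ Y ≈ Y∖X
      Y-split = ≈-trans (ℙ-split mY mX) (≈-trans
        (+-cong (≈-trans (ℙ-cong (λ ω → Bool.∧-comm (Y ω) (X ω))) ℙXY≈0) (ℙ-cong (λ ω → Bool.∧-comm (Y ω) (not (X ω)))))
        (+-identityˡ _))

    -- Almost surely exactly one of X and Y occurs, so at most four outcomes carry mass. The
    -- inclusion between X and Y′ then kills X without Y′ (`p`) or Y′ without X (`s`).
    kindB : ℙ Y ≈ 1# - ℙ X → (∀ ω → X ω ∧ not (Y′ ω) ≡ false) ⊎ (∀ ω → not (X ω) ∧ Y′ ω ≡ false) →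
      Σ[ κ ∈ Kind ] (∀ t → L t ≈ law κ t)
    kindB ℙY≈1-ℙX nested = caseB p r q s (0≤L _) (0≤L _) (0≤L _) (0≤L _) sum p≈0⊎s≈0 , agree
      where
      p = L (true , false , false)
      r = L (true , false , true)
      q = L (false , true , false)
      s = L (false , true , true)

      none : ∀ y′ → L (false , false , y′) ≈ 0#
      none y′ = null⇒L≈0 (λ { (x , y , _) → not x ∧ not y }) (measurable-∩ (measurable-∁ mX) (measurable-∁ mY))
        (neither-null ℙY≈1-ℙX) (false , false , y′) ≡.refl

      p≈0⊎s≈0 : p ≈ 0# ⊎ s ≈ 0#
      p≈0⊎s≈0 = Sum.map
        (λ X⊆Y′ → null⇒L≈0 (λ { (x , _ , y′) → x ∧ not y′ }) (measurable-∩ mX (measurable-∁ mY′))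
          (≈-trans (ℙ-cong X⊆Y′) ℙ-∅) _ ≡.refl)
        (λ Y′⊆X → null⇒L≈0 (λ { (x , _ , y′) → not x ∧ y′ }) (measurable-∩ (measurable-∁ mX) mY′)
          (≈-trans (ℙ-cong Y′⊆X) ℙ-∅) _ ≡.refl)
        nested

      sum : (p + q) + (r + s) ≈ 1#
      sum = begin-equality
        (p + q) + (r + s)
          ≈⟨ solve 4 (λ p r q s → (p :+ q) :+ (r :+ s) :=
               con 0 :+ (con 0 :+ (q :+ (s :+ (p :+ (r :+ (con 0 :+ (con 0 :+ con 0)))))))) ≈-refl p r q s ⟩
        0# + (0# + (q + (s + (p + (r + (0# + (0# + 0#)))))))
          ≈⟨ +-cong (≈-sym (none false)) (+-cong (≈-sym (none true)) (+-congˡ (+-congˡ (+-congˡ (+-congˡ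
               (+-cong (≈-sym (xy-null false)) (+-congʳ (≈-sym (xy-null true))))))))) ⟩
        _           ≈⟨ ∑-triples L ⟨
        ∑ triples L ≈⟨ ∑-lawOf Z measurable-triple ⟩
        1#          ∎

      agree : ∀ t → L t ≈ law (caseB p r q s (0≤L _) (0≤L _) (0≤L _) (0≤L _) sum p≈0⊎s≈0) t
      agree (false , false , false) = none false
      agree (false , false , true)  = none true
      agree (false , true  , false) = ≈-refl
      agree (false , true  , true)  = ≈-refl
      agree (true  , false , false) = ≈-refl
      agree (true  , false , true)  = ≈-refl
      agree (true  , true  , false) = xy-null false
      agree (true  , true  , true)  = xy-null true

  threshold-mono : ∀ x {s t} → s ≤ t → does (x <? s) ∧ not (does (x <? t)) ≡ false
  threshold-mono x {s} {t} s≤t = does-⇒ (x <? s) (x <? t) λ (x≤s , x≉s) →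
    ≤-trans x≤s s≤t , λ x≈t → x≉s (antisym x≤s (≤-trans s≤t (≤-reflexive (≈-sym x≈t))))

  ratio-0 : ∀ x y → ratio 0# x y ≈ fromℕ x * recip (x ℕ.+ y)
  ratio-0 zero    zero    = ≈-sym (zeroˡ 0#)
  ratio-0 zero    (suc y) = ≈-refl
  ratio-0 (suc x) y       = ≈-refl

  -- The value 1 for 0/0 complements the value 0 that `recip` gives to the share of Y, so the two
  -- shares add up to 1 even when both counts vanish.
  ratio-1 : ∀ x y → ratio 1# x y + fromℕ y * recip (x ℕ.+ y) ≈ 1#
  ratio-1 zero    zero    = ≈-trans (+-congˡ (zeroˡ 0#)) (+-identityʳ 1#)
  ratio-1 zero    (suc y) = ≈-trans (+-congʳ (zeroˡ _)) (≈-trans (+-identityˡ _) (*-inverseʳ (fromℕ-suc≉0 y)))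
  ratio-1 (suc x) y       = ≈-trans (≈-sym (distribʳ _ _ _))
    (≈-trans (*-congʳ (≈-sym (fromℕ-+ (suc x) y))) (*-inverseʳ (fromℕ-suc≉0 (x ℕ.+ y))))

  x*D⁻¹≤y : ∀ {x y D} → 0# ≤ D → ¬ (D ≈ 0#) → x ≤ D * y → x / D ≤ y
  x*D⁻¹≤y {x} {y} {D} 0≤D D≉0 x≤Dy = begin
    x * D ⁻¹        ≤⟨ *-monoʳ-≤ (D ⁻¹) (⁻¹-nonNegative 0≤D D≉0) x≤Dy ⟩
    D * y * D ⁻¹    ≈⟨ solve 3 (λ d y e → d :* y :* e := d :* e :* y) ≈-refl D y (D ⁻¹) ⟩
    D * D ⁻¹ * y    ≈⟨ *-congʳ (*-inverseʳ D≉0) ⟩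
    1# * y          ≈⟨ *-identityˡ y ⟩
    y               ∎

  y≤x*D⁻¹ : ∀ {x y D} → 0# ≤ D → ¬ (D ≈ 0#) → D * y ≤ x → y ≤ x / D
  y≤x*D⁻¹ {x} {y} {D} 0≤D D≉0 Dy≤x = begin
    y               ≈⟨ *-identityˡ y ⟨
    1# * y          ≈⟨ *-congʳ (*-inverseʳ D≉0) ⟨
    D * D ⁻¹ * y    ≈⟨ solve 3 (λ d y e → d :* e :* y := d :* y :* e) ≈-refl D y (D ⁻¹) ⟩
    D * y * D ⁻¹    ≤⟨ *-monoʳ-≤ (D ⁻¹) (⁻¹-nonNegative 0≤D D≉0) Dy≤x ⟩
    x * D ⁻¹        ∎

  -- Both inequalities for independent triples of given kinds.

  module _ {n : ℕ} (κ : Fin n → Kind) where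

    private
      𝔼κ : (Vec Triple n → Carrier) → Carrier
      𝔼κ = E (law ∘ κ)

      μx = 𝔼κ (λ v → fromℕ (∑X v))
      μy = 𝔼κ (λ v → fromℕ (∑Y v))
      D  = μx + μy - 1#

    module _ (1<μ : 1# < μx + μy) where

      private
        D+1≈μ : D + 1# ≈ μx + μy
        D+1≈μ = ≈-trans (+-assoc _ _ _) (≈-trans (+-congˡ (-‿inverseˡ 1#)) (+-identityʳ _))

        0≤D : 0# ≤ D
        0≤D = ≤-trans (≤-reflexive (≈-sym (-‿inverseʳ 1#))) (+-monoˡ-≤ (- 1#) (proj₁ 1<μ))

        D≉0 : ¬ (D ≈ 0#)
        D≉0 D≈0 = proj₂ 1<μ (≈-trans (≈-sym (+-identityˡ 1#)) (≈-trans (+-congʳ (≈-sym D≈0)) D+1≈μ))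

        size≡ : ∀ (v : Vec Triple n) → total size v ≡ ∑X v ℕ.+ ∑Y v
        size≡ v = ≡.trans (total-size v) (≡.sym (≡.cong₂ ℕ._+_ (∑X≡total v) (∑Y≡total v)))

        bound : ∀ w (count : Vec Triple n → ℕ) → (∀ κ → Fair w κ) → (∀ v → count v ≡ total w v) →
          D * 𝔼κ (λ v → fromℕ (count v) * recip (∑X v ℕ.+ ∑Y v)) ≤ 𝔼κ (λ v → fromℕ (count v))
        bound w count fair count≡ = begin
          D * 𝔼κ (λ v → fromℕ (count v) * recip (∑X v ℕ.+ ∑Y v))
            ≈⟨ *-congˡ (E-cong (law ∘ κ) (λ v → ≈-reflexive (≡.cong₂ (λ k l → fromℕ k * recip l) (count≡ v) (≡.sym (size≡ v))))) ⟩
          D * 𝔼κ (λ v → fromℕ (total w v) * recip (total size v))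
            -- No triple has been treated yet, so `βs` starts empty and `𝔼-shifts [] recip` is
            -- `recip` itself.
            ≤⟨ Fair⇒bound w fair κ [] D (≈-trans D+1≈μ (≈-trans (≈-sym (E-+ (law ∘ κ) _ _)) (≈-trans
                 (E-cong (law ∘ κ) (λ v → ≈-trans (≈-sym (fromℕ-+ (∑X v) (∑Y v))) (≈-reflexive (≡.cong fromℕ (≡.sym (size≡ v))))))
                 (≈-sym (+-identityˡ _))))) ⟩
          𝔼κ (λ v → fromℕ (total w v))
            ≈⟨ E-cong (law ∘ κ) (λ v → ≈-reflexive (≡.cong fromℕ (≡.sym (count≡ v)))) ⟩
          𝔼κ (λ v → fromℕ (count v)) ∎

      upper-bound : 𝔼κ (λ v → ratio 0# (∑X v) (∑Y v)) ≤ μx / D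
      upper-bound = ≤-trans (≤-reflexive (E-cong (law ∘ κ) (λ v → ratio-0 (∑X v) (∑Y v))))
        (y≤x*D⁻¹ 0≤D D≉0 (bound xCount ∑X fair-x ∑X≡total))

      -- The complementary ratio Y/(X+Y), with 0/0 read as 0, is bounded like the upper bound.
      lower-bound : (μx - 1#) / D ≤ 𝔼κ (λ v → ratio 1# (∑X v) (∑Y v))
      lower-bound = x*D⁻¹≤y 0≤D D≉0 (+-cancelʳ-≤ μy (begin
        -- With the denominator cleared, adding `μy` turns `μx - 1#` into `D`. Writing 1 as the sum
        -- of the two shares splits `D`, and the share of Y costs at most `μy`.
        μx - 1# + μy           ≈⟨ solve 3 (λ x y e → x :+ e :+ y := x :+ y :+ e) ≈-refl μx μy (- 1#) ⟩
        D                      ≈⟨ *-identityʳ D ⟨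
        D * 1#                 ≈⟨ *-congˡ (≈-sym (≈-trans (≈-sym (E-+ (law ∘ κ) _ _)) (≈-trans
                                    (E-cong (law ∘ κ) (λ v → ratio-1 (∑X v) (∑Y v))) (E-1 (law ∘ κ) (∑-law ∘ κ))))) ⟩
        D * (𝔼κ (λ v → ratio 1# (∑X v) (∑Y v)) + 𝔼κ (λ v → fromℕ (∑Y v) * recip (∑X v ℕ.+ ∑Y v)))
                               ≈⟨ distribˡ D _ _ ⟩
        D * 𝔼κ (λ v → ratio 1# (∑X v) (∑Y v)) + D * 𝔼κ (λ v → fromℕ (∑Y v) * recip (∑X v ℕ.+ ∑Y v))
                               ≤⟨ +-mono-≤ ≤-refl (bound yCount ∑Y fair-y ∑Y≡total) ⟩
        D * 𝔼κ (λ v → ratio 1# (∑X v) (∑Y v)) + μy ∎))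

-- Transfer to the given random variables.

theorem4 : {c ℓ₁ ℓ₂ o m : Level} (F : OrderedField c ℓ₁ ℓ₂) (S : ProbabilitySpace F o m) →
    let open OrderedField F
        open ProbabilitySpace S
        open Probability F S
    in
    (n : ℕ) (X Y Y′ : Fin n → Ω → Bool) (p q q′ : Fin n → Carrier) →
    (∀ i → Measurable (X i)) → (∀ i → Measurable (Y i)) → (∀ i → Measurable (Y′ i)) →
    Independent (λ i ω → (X i ω , Y i ω , Y′ i ω)) →
    (∀ i → 𝔼 (X i) (λ x → fromℕ (bit x)) ≈ p i) →
    (∀ i → 𝔼 (Y i) (λ y → fromℕ (bit y)) ≈ q i) →
    (∀ i → 𝔼 (Y′ i) (λ y′ → fromℕ (bit y′)) ≈ q′ i) →
    (∀ i → 𝔼 (λ ω → (X i ω , Y i ω)) (λ (x , y) → fromℕ (bit x ℕ.* bit y)) ≈ 0#) →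
    (∀ i →
      (q′ i ≈ 0#)
      ⊎
      ((q i ≈ 1# - p i) ×
       (Σ[ θ ∈ (Ω → Carrier) ]
         (Uniform[0,1] θ ×
          (∀ ω → X i ω ≡ does (θ ω <? p i)) ×
          (∀ ω → Y′ i ω ≡ does (θ ω <? q′ i)))))) →
    let T : Ω → Vec Triple n
        T = λ ω → tabulate (λ i → (X i ω , Y i ω , Y′ i ω))
        μx = 𝔼 T (λ t → fromℕ (∑X t))
        μy = 𝔼 T (λ t → fromℕ (∑Y t))
    in
    1# < μx + μy →
    ((μx - 1#) / (μx + μy - 1#) ≤ 𝔼 T (λ t → ratio 1# (∑X t) (∑Y t))) ×
    (𝔼 T (λ t → ratio 0# (∑X t) (∑Y t)) ≤ μx / (μx + μy - 1#))
theorem4 F S n X Y Y′ p q q′ mX mY mY′ ind 𝔼X 𝔼Y 𝔼Y′ 𝔼XY cases (1≤μ , 1≉μ) =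
  ≤-trans (≤-reflexive (*-cong (+-congʳ μx≈) D⁻¹≈)) (≤-trans (lower-bound κ 1<μ) (≤-reflexive (≈-sym (toκ _)))) ,
  ≤-trans (≤-reflexive (toκ _)) (≤-trans (upper-bound κ 1<μ) (≤-reflexive (≈-sym (*-cong μx≈ D⁻¹≈))))
  where
  open OrderedField F
  open ProbabilitySpace S
  open Probability F S
  open OrderedFieldProperties F
  open ProductLaws F
  open Bounds F
  open ProbabilityProperties F S

  kindOf : ∀ i → Σ[ κ ∈ Kind ] (∀ t → lawOf (λ ω → X i ω , Y i ω , Y′ i ω) t ≈ law κ t)
  kindOf i with cases i
  ... | inj₁ q′≈0 = kindA (mX i) (mY i) (mY′ i) (≈-trans (≈-sym (𝔼-bit*bit (X i) (Y i))) (𝔼XY i))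
    (≈-trans (≈-sym (𝔼-bit (Y′ i))) (≈-trans (𝔼Y′ i) q′≈0))
  ... | inj₂ (q≈1-p , θ , _ , X≡ , Y′≡) = kindB (mX i) (mY i) (mY′ i) (≈-trans (≈-sym (𝔼-bit*bit (X i) (Y i))) (𝔼XY i))
    (≈-trans (≈-sym (𝔼-bit (Y i))) (≈-trans (𝔼Y i) (≈-trans q≈1-p
      (+-congˡ (-‿cong (≈-trans (≈-sym (𝔼X i)) (𝔼-bit (X i))))))))
    nested
    where
    nested : (∀ ω → X i ω ∧ not (Y′ i ω) ≡ false) ⊎ (∀ ω → not (X i ω) ∧ Y′ i ω ≡ false)
    -- Both events are thresholds of the same `θ`, so the order of `p i` and `q′ i` decides which
    -- event contains the other, at every point of Ω.
    nested with ≤-total (p i) (q′ i)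
    ... | inj₁ p≤q′ = inj₁ λ ω →
      ≡.trans (≡.cong₂ (λ x y′ → x ∧ not y′) (X≡ ω) (Y′≡ ω)) (threshold-mono (θ ω) p≤q′)
    ... | inj₂ q′≤p = inj₂ λ ω →
      ≡.trans (≡.cong₂ (λ x y′ → not x ∧ y′) (X≡ ω) (Y′≡ ω)) 
        (≡.trans (Bool.∧-comm (not (does (θ ω <? p i))) (does (θ ω <? q′ i))) (threshold-mono (θ ω) q′≤p))

  κ : Fin n → Kind
  κ i = proj₁ (kindOf i)

  toκ : ∀ g → 𝔼 (λ ω → tabulate (λ i → (X i ω , Y i ω , Y′ i ω))) g ≈ E (law ∘ κ) g
  toκ g = ≈-trans (𝔼≈E (λ i ω → X i ω , Y i ω , Y′ i ω) ind g) (E-law-cong (λ i → proj₂ (kindOf i)) g)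

  μx≈ = toκ (λ t → fromℕ (∑X t))
  μy≈ = toκ (λ t → fromℕ (∑Y t))
  D⁻¹≈ = ⁻¹-cong (+-congʳ {x = - 1#} (+-cong μx≈ μy≈))

  1<μ : 1# < E (law ∘ κ) (λ t → fromℕ (∑X t)) + E (law ∘ κ) (λ t → fromℕ (∑Y t))
  1<μ = ≤-trans 1≤μ (≤-reflexive (+-cong μx≈ μy≈)) , λ 1≈μ → 1≉μ (≈-trans 1≈μ (≈-sym (+-cong μx≈ μy≈)))
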